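{- Let $0\le k\le n$ be integers with $n\ge 1$. Smooth torus orbit closures in $G_k(\mathbb{C}^n)$ are uniquely determined by their corresponding (simple) matroid polytopes: if $X,Y\in G_k(\mathbb{C}^n)$ are such that $\overline{TX}$ and $\overline{TY}$ are smooth and $\mu(\overline{TX})=\mu(\overline{TY})$, then $\overline{TX}=\overline{TY}$.
   Context: $G_k(\mathbb{C}^n)$ is the Grassmannian of $k$-dimensional complex linear subspaces of $\mathbb{C}^n$. $T=(\mathbb{C}^*)^n$ acts on $\mathbb{C}^n$ by coordinatewise multiplication and hence acts on $G_k(\mathbb{C}^n)$. $TX$ is the $T$-orbit of $X$ and $\overline{TX}$ is its closure in $G_k(\mathbb{C}^n)$, regarded as a (reduced) subvariety. For $J\subset[n]=\{1,\dots,n\}$, $\delta_J\in\mathbb{R}^n$ is the indicator vector of $J$. Represent $X\in G_k(\mathbb{C}^n)$ by an $n\times k$ matrix $A$ whose columns form a basis of $X$; for a $k$-element subset $J$ of $[n]$, $P^J(X)$ is the $k\times k$ minor of $A$ formed by the rows with indices in $J$ (well defined up to a common nonzero factor; for $k=0$ the empty minor is $1$). The moment map $\mu\colon G_k(\mathbb{C}^n)\to\mathbb{R}^n$ is $$\mu(X)=\frac{\sum_{J\subset[n],\,|J|=k}|P^J(X)|^2\,\delta_J}{\sum_{J\subset[n],\,|J|=k}|P^J(X)|^2}.$$ It is known that $\mu(\overline{TX})$ is the convex hull of $\{\delta_J\mid P^J(X)\ne0\}$; it is called the matroid polytope corresponding to $\overline{TX}$. -}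

module Defs where

open import Algebra.Bundles using (CommutativeRing)
import Algebra.Consequences.Setoid as Consequences
import Algebra.Properties.Ring as RingProperties
import Algebra.Properties.Semiring.Exp as Exp
import Algebra.Properties.Semiring.Sum as Sum
import Algebra.Solver.Ring.NaturalCoefficients.Default as SemiringSolver
open import Data.Bool.Base using (if_then_else_)
open import Data.Fin.Base using (Fin; zero; suc; toℕ; punchIn)
open import Data.Fin.Properties using () renaming (_≟_ to _≟ᶠ_)
open import Data.List.Base using (List; []; _∷_; _++_; map; foldr)
open import Data.Nat.Base using (ℕ; zero; suc)
import Data.Nat.Base as ℕ using (_+_)
open import Data.Product.Base using (_×_; _,_; ∃; proj₁; proj₂)
open import Data.Product.Properties using (≡-dec)
open import Data.Sum.Base using (_⊎_; inj₁; inj₂)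
import Data.Sum.Base as ⊎
open import Data.Vec.Functional using (Vector)
open import Level using (0ℓ) renaming (suc to lsuc)
open import Relation.Binary.Bundles using (Setoid)
open import Relation.Binary.Core using (Rel)
open import Relation.Binary.Definitions using (DecidableEquality)
open import Relation.Binary.PropositionalEquality.Core as ≡ using (_≡_; refl)
open import Relation.Binary.Structures using (IsStrictTotalOrder)
open import Relation.Nullary.Decidable.Core using (does)
open import Relation.Nullary.Negation.Core using (¬_)
open import Relation.Unary using (Pred; _∈_)
import Relation.Binary.Reasoning.Setoid as SetoidReasoning

-- The axioms of a Dedekind-complete ordered field.  They determine ℝ up to
-- unique isomorphism, so an arbitrary model serves as the real numbers.
-- The inverse is total; its value at 0 is unspecified.
record CompleteOrderedField : Set (lsuc 0ℓ) where
  field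
    commutativeRing : CommutativeRing 0ℓ 0ℓ

  open CommutativeRing commutativeRing public

  infix  4 _<_
  infixl 8 _⁻¹

  field
    _<_                : Rel Carrier 0ℓ
    isStrictTotalOrder : IsStrictTotalOrder _≈_ _<_
    +-monoˡ-<          : ∀ z {x y} → x < y → x + z < y + z
    *-pos              : ∀ {x y} → 0# < x → 0# < y → 0# < x * y
    0≉1                : ¬ (0# ≈ 1#)
    _⁻¹                : Carrier → Carrier
    ⁻¹-inverseʳ        : ∀ x → ¬ (x ≈ 0#) → x * x ⁻¹ ≈ 1#

  UpperBound : Pred Carrier 0ℓ → Pred Carrier 0ℓ
  UpperBound P b = ∀ x → x ∈ P → ¬ (b < x)

  field
    complete : (P : Pred Carrier 0ℓ) → ∃ P → ∃ (UpperBound P) →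
               ∃ λ s → s ∈ UpperBound P × (∀ b → b ∈ UpperBound P → ¬ (b < s))

infix 4 _⊑_

-- J : k ⊑ n is a k-element subset of Fin n: each element of Fin n in turn is
-- taken or skipped.
data _⊑_ : ℕ → ℕ → Set where
  done : zero ⊑ zero
  take : ∀ {k n} → k ⊑ n → suc k ⊑ suc n
  skip : ∀ {k n} → k ⊑ n → k ⊑ suc n

-- The elements of J in increasing order.
elem : ∀ {k n} → k ⊑ n → Fin k → Fin n
elem (take J) zero    = zero
elem (take J) (suc p) = suc (elem J p)
elem (skip J) p       = suc (elem J p)

-- The number n - k of elements outside J.
codim : ∀ {k n} → k ⊑ n → ℕ
codim done     = zero
codim (take J) = codim J
codim (skip J) = suc (codim J)

-- i ↦ inj₁ p when i is the p-th element of J, and i ↦ inj₂ q when i is the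
-- q-th element of the complement of J.
position : ∀ {k n} (J : k ⊑ n) → Fin n → Fin k ⊎ Fin (codim J)
position (take J) zero    = inj₁ zero
position (take J) (suc i) = ⊎.map₁ suc (position J i)
position (skip J) zero    = inj₂ zero
position (skip J) (suc i) = ⊎.map₂ suc (position J i)

position-elem : ∀ {k n} (J : k ⊑ n) p → position J (elem J p) ≡ inj₁ p
position-elem (take J) zero    = refl
position-elem (take J) (suc p) = ≡.cong (⊎.map₁ suc) (position-elem J p)
position-elem (skip J) p       = ≡.cong (⊎.map₂ suc) (position-elem J p)

allSubsets : ∀ k n → List (k ⊑ n)
allSubsets zero    zero    = done ∷ []
allSubsets (suc k) zero    = []
allSubsets zero    (suc n) = map skip (allSubsets zero n)
allSubsets (suc k) (suc n) =
  map take (allSubsets k n) ++ map skip (allSubsets (suc k) n)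

module Grassmannian (ℝ : CompleteOrderedField) where

  private
    module R where
      open CompleteOrderedField ℝ public

      -‿scale : ∀ x → - x ≈ - 1# * x
      -‿scale x = sym (RingProperties.-1*x≈-x ring x)

      open SemiringSolver commutativeSemiring public
        using (solve; _:=_; _:+_; _:*_)

  -- ℂ = ℝ × ℝ, where (a , b) stands for a + b i.
  ℂ-commutativeRing : CommutativeRing 0ℓ 0ℓ
  ℂ-commutativeRing = record
    { Carrier = R.Carrier × R.Carrier
    ; _≈_ = _≈_
    ; _+_ = _+_
    ; _*_ = _*_
    ; -_  = λ (a , b) → (R.- a) , (R.- b)
    ; 0#  = R.0# , R.0#
    ; 1#  = R.1# , R.0#
    ; isCommutativeRing = record
      { isRing = record
        { +-isAbelianGroup = record
          { isGroup = record
            { isMonoid = record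
              { isSemigroup = record
                { isMagma = record
                  { isEquivalence = Setoid.isEquivalence S
                  ; ∙-cong = +-cong
                  }
                ; assoc = λ _ _ _ → R.+-assoc _ _ _ , R.+-assoc _ _ _
                }
              ; identity = (λ _ → R.+-identityˡ _ , R.+-identityˡ _)
                         , (λ _ → R.+-identityʳ _ , R.+-identityʳ _)
              }
            ; inverse = (λ _ → R.-‿inverseˡ _ , R.-‿inverseˡ _)
                      , (λ _ → R.-‿inverseʳ _ , R.-‿inverseʳ _)
            ; ⁻¹-cong = λ (p , q) → R.-‿cong p , R.-‿cong q
            }
          ; comm = λ _ _ → R.+-comm _ _ , R.+-comm _ _
          }
        ; *-cong = *-cong
        ; *-assoc = *-assoc
        ; *-identity = comm∧idˡ⇒id *-comm *-identityˡ
        ; distrib = comm∧distrˡ⇒distr +-cong *-comm distribˡ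
        }
      ; *-comm = *-comm
      }
    }
    where
    C : Set
    C = R.Carrier × R.Carrier

    infix  4 _≈_
    infixl 7 _*_
    infixl 6 _+_

    _≈_ : Rel C 0ℓ
    (a , b) ≈ (c , d) = (a R.≈ c) × (b R.≈ d)

    _+_ _*_ : C → C → C
    (a , b) + (c , d) = (a R.+ c) , (b R.+ d)
    (a , b) * (c , d) = (a R.* c R.- b R.* d) , (a R.* d R.+ b R.* c)

    S : Setoid 0ℓ 0ℓ
    S = record
      { Carrier = C
      ; _≈_ = _≈_
      ; isEquivalence = record
        { refl  = R.refl , R.refl
        ; sym   = λ (p , q) → R.sym p , R.sym q
        ; trans = λ (p , q) (r , s) → R.trans p r , R.trans q s
        }
      }

    open Consequences S using (comm∧idˡ⇒id; comm∧distrˡ⇒distr)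

    +-cong : ∀ {x y u v} → x ≈ y → u ≈ v → x + u ≈ y + v
    +-cong (p , q) (r , s) = R.+-cong p r , R.+-cong q s

    *-cong : ∀ {x y u v} → x ≈ y → u ≈ v → x * u ≈ y * v
    *-cong (p , q) (r , s) =
        R.+-cong (R.*-cong p r) (R.-‿cong (R.*-cong q s))
      , R.+-cong (R.*-cong p s) (R.*-cong q r)

    *-comm : ∀ x y → x * y ≈ y * x
    *-comm (a , b) (c , d) =
        R.+-cong (R.*-comm a c) (R.-‿cong (R.*-comm b d))
      , R.trans (R.+-comm _ _) (R.+-cong (R.*-comm b c) (R.*-comm a d))

    *-identityˡ : ∀ x → (R.1# , R.0#) * x ≈ x
    *-identityˡ (a , b) =
        R.trans (R.+-cong (R.*-identityˡ a) (R.trans (R.-‿cong (R.zeroˡ b))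
                  (RingProperties.-0#≈0# R.ring))) (R.+-identityʳ a)
      , R.trans (R.+-cong (R.*-identityˡ b) (R.zeroˡ a)) (R.+-identityʳ b)

    distribˡ : ∀ x y z → x * (y + z) ≈ x * y + x * z
    distribˡ (a , b) (c , d) (e , f) =
        (begin
          a R.* (c R.+ e) R.- b R.* (d R.+ f)
            ≈⟨ R.+-congˡ (R.-‿scale _) ⟩
          a R.* (c R.+ e) R.+ n R.* (b R.* (d R.+ f))
            ≈⟨ R.solve 7 (λ n a b c d e f →
                 a :* (c :+ e) :+ n :* (b :* (d :+ f))
                 := (a :* c :+ n :* (b :* d)) :+ (a :* e :+ n :* (b :* f)))
               R.refl n a b c d e f ⟩
          (a R.* c R.+ n R.* (b R.* d)) R.+ (a R.* e R.+ n R.* (b R.* f))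
            ≈⟨ R.+-cong (R.+-congˡ (R.-‿scale _)) (R.+-congˡ (R.-‿scale _)) ⟨
          (a R.* c R.- b R.* d) R.+ (a R.* e R.- b R.* f) ∎)
      , R.solve 6 (λ a b c d e f →
          a :* (d :+ f) :+ b :* (c :+ e)
          := (a :* d :+ b :* c) :+ (a :* f :+ b :* e))
        R.refl a b c d e f
      where
      open SetoidReasoning R.setoid
      open R using (_:+_; _:*_; _:=_)
      n = R.- R.1#

    *-assoc : ∀ x y z → (x * y) * z ≈ x * (y * z)
    *-assoc (a , b) (c , d) (e , f) =
        (begin
          (a R.* c R.- b R.* d) R.* e R.- (a R.* d R.+ b R.* c) R.* f
            ≈⟨ R.+-cong (R.*-congʳ (R.+-congˡ (R.-‿scale _))) (R.-‿scale _) ⟩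
          (a R.* c R.+ n R.* (b R.* d)) R.* e R.+ n R.* ((a R.* d R.+ b R.* c) R.* f)
            ≈⟨ R.solve 7 (λ n a b c d e f →
                 (a :* c :+ n :* (b :* d)) :* e :+ n :* ((a :* d :+ b :* c) :* f)
                 := a :* (c :* e :+ n :* (d :* f)) :+ n :* (b :* (c :* f :+ d :* e)))
               R.refl n a b c d e f ⟩
          a R.* (c R.* e R.+ n R.* (d R.* f)) R.+ n R.* (b R.* (c R.* f R.+ d R.* e))
            ≈⟨ R.+-cong (R.*-congˡ (R.+-congˡ (R.-‿scale _))) (R.-‿scale _) ⟨
          a R.* (c R.* e R.- d R.* f) R.- b R.* (c R.* f R.+ d R.* e) ∎)
      , (begin
          (a R.* c R.- b R.* d) R.* f R.+ (a R.* d R.+ b R.* c) R.* e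
            ≈⟨ R.+-congʳ (R.*-congʳ (R.+-congˡ (R.-‿scale _))) ⟩
          (a R.* c R.+ n R.* (b R.* d)) R.* f R.+ (a R.* d R.+ b R.* c) R.* e
            ≈⟨ R.solve 7 (λ n a b c d e f →
                 (a :* c :+ n :* (b :* d)) :* f :+ (a :* d :+ b :* c) :* e
                 := a :* (c :* f :+ d :* e) :+ b :* (c :* e :+ n :* (d :* f)))
               R.refl n a b c d e f ⟩
          a R.* (c R.* f R.+ d R.* e) R.+ b R.* (c R.* e R.+ n R.* (d R.* f))
            ≈⟨ R.+-congˡ (R.*-congˡ (R.+-congˡ (R.-‿scale _))) ⟨
          a R.* (c R.* f R.+ d R.* e) R.+ b R.* (c R.* e R.- d R.* f) ∎)
      where
      open SetoidReasoning R.setoid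
      open R using (_:+_; _:*_; _:=_)
      n = R.- R.1#

  open CommutativeRing ℂ-commutativeRing public
    using (_≈_; _+_; _*_; -_; 0#; 1#)
    renaming (Carrier to ℂ)
  private module C = CommutativeRing ℂ-commutativeRing
  open Sum C.semiring public using (sum)
  open Exp C.semiring public using (_^_)

  ∥_∥² : ℂ → R.Carrier
  ∥ a , b ∥² = a R.* a R.+ b R.* b

  Matrix : ℕ → ℕ → Set
  Matrix m n = Fin m → Fin n → ℂ

  infixl 7 _·_

  _·_ : ∀ {m n} → Matrix m n → Vector ℂ n → Vector ℂ m
  (A · c) i = sum λ j → A i j * c j

  δ : ∀ {k} → Fin k → Fin k → ℂ
  δ i j = if does (i ≟ᶠ j) then 1# else 0#

  -- Laplace expansion along the first row.
  det : ∀ {k} → Matrix k k → ℂ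
  det {zero}  A = 1#
  det {suc k} A = sum λ j →
    (- 1#) ^ toℕ j * A zero j * det (λ p q → A (suc p) (punchIn j q))

  -- A point of G_k(ℂⁿ) is given by a basis of a subspace, arranged as the
  -- columns of a matrix.  Different matrices may present the same subspace;
  -- everything below depends on the subspace only.
  record Gr (k n : ℕ) : Set where
    field
      matrix      : Matrix n k
      independent : ∀ c → (∀ i → (matrix · c) i ≈ 0#) → ∀ j → c j ≈ 0#

  open Gr public

  ⟨_⟩ : ∀ {k n} → Gr k n → Pred (Vector ℂ n) 0ℓ
  ⟨ X ⟩ v = ∃ λ c → ∀ i → v i ≈ (matrix X · c) i

  record Torus (n : ℕ) : Set where
    field
      coord   : Vector ℂ n
      nonzero : ∀ i → ¬ (coord i ≈ 0#)

  open Torus public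

  -- Z = tX as subspaces of ℂⁿ.
  _IsTranslateOf_By_ : ∀ {k n} → Gr k n → Gr k n → Torus n → Set
  Z IsTranslateOf X By t =
      (∀ v → v ∈ ⟨ X ⟩ → (λ i → coord t i * v i) ∈ ⟨ Z ⟩)
    × (∀ w → w ∈ ⟨ Z ⟩ → ∃ λ v → v ∈ ⟨ X ⟩ × (∀ i → w i ≈ coord t i * v i))

  Orbit : ∀ {k n} → Gr k n → Pred (Gr k n) 0ℓ
  Orbit X Z = ∃ λ t → Z IsTranslateOf X By t

  Plücker : ∀ {k n} → Gr k n → k ⊑ n → ℂ
  Plücker X J = det λ p q → matrix X (elem J p) q

  -- Polynomials over ℂ in a set V of variables.  As ℂ is infinite, two
  -- expressions denote the same polynomial iff they have the same values.

  infixl 6 _⊕_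
  infixl 7 _⊗_

  data Poly (V : Set) : Set where
    con     : ℂ → Poly V
    var     : V → Poly V
    _⊕_ _⊗_ : Poly V → Poly V → Poly V

  ⟦_⟧ : ∀ {V} → Poly V → (V → ℂ) → ℂ
  ⟦ con c ⟧ x = c
  ⟦ var v ⟧ x = x v
  ⟦ p ⊕ q ⟧ x = ⟦ p ⟧ x + ⟦ q ⟧ x
  ⟦ p ⊗ q ⟧ x = ⟦ p ⟧ x * ⟦ q ⟧ x

  ∂ : ∀ {V} → DecidableEquality V → V → Poly V → Poly V
  ∂ _≟_ v (con c) = con 0#
  ∂ _≟_ v (var w) = con (if does (v ≟ w) then 1# else 0#)
  ∂ _≟_ v (p ⊕ q) = ∂ _≟_ v p ⊕ ∂ _≟_ v q
  ∂ _≟_ v (p ⊗ q) = ∂ _≟_ v p ⊗ q ⊕ p ⊗ ∂ _≟_ v q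

  data Homogeneous {V : Set} : ℕ → Poly V → Set where
    con : ∀ c → Homogeneous 0 (con c)
    var : ∀ v → Homogeneous 1 (var v)
    _⊕_ : ∀ {d p q} → Homogeneous d p → Homogeneous d q → Homogeneous d (p ⊕ q)
    _⊗_ : ∀ {d e p q} → Homogeneous d p → Homogeneous e q →
          Homogeneous (d ℕ.+ e) (p ⊗ q)

  -- The Zariski closure, with G_k(ℂⁿ) a projective variety via the Plücker
  -- embedding.
  Closure : ∀ {k n} → Pred (Gr k n) 0ℓ → Pred (Gr k n) 0ℓ
  Closure {k} {n} S Z =
    ∀ d (F : Poly (k ⊑ n)) → Homogeneous d F →
    (∀ W → W ∈ S → ⟦ F ⟧ (Plücker W) ≈ 0#) → ⟦ F ⟧ (Plücker Z) ≈ 0#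

  OrbitClosure : ∀ {k n} → Gr k n → Pred (Gr k n) 0ℓ
  OrbitClosure X = Closure (Orbit X)

  -- The chart of J consists of the subspaces X with P^J(X) ≠ 0.  Such an X has
  -- exactly one matrix whose rows in J form the identity; the remaining
  -- entries are the affine coordinates of X.
  Coord : ∀ {k n} → k ⊑ n → Set
  Coord {k} J = Fin (codim J) × Fin k

  _≟ᶜ_ : ∀ {k n} {J : k ⊑ n} → DecidableEquality (Coord J)
  _≟ᶜ_ = ≡-dec _≟ᶠ_ _≟ᶠ_

  chartMatrix : ∀ {k n} (J : k ⊑ n) → (Coord J → ℂ) → Matrix n k
  chartMatrix J a i j with position J i
  ... | inj₁ p = δ p j
  ... | inj₂ q = a (q , j)

  chartMatrix-elem : ∀ {k n} (J : k ⊑ n) a p j →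
                     chartMatrix J a (elem J p) j ≡ δ p j
  chartMatrix-elem J a p j rewrite position-elem J p = refl

  sum-0 : ∀ {k} (c : Vector ℂ k) → sum (λ j → 0# * c j) ≈ 0#
  sum-0 {zero}  c = C.refl
  sum-0 {suc k} c = C.trans (C.+-cong (C.zeroˡ _) (sum-0 (λ j → c (suc j))))
                            (C.+-identityˡ 0#)

  sum-δ : ∀ {k} (p : Fin k) (c : Vector ℂ k) → sum (λ j → δ p j * c j) ≈ c p
  sum-δ zero    c = C.trans (C.+-cong (C.*-identityˡ _) (sum-0 (λ j → c (suc j))))
                            (C.+-identityʳ _)
  sum-δ (suc p) c = C.trans (C.+-cong (C.zeroˡ _) (sum-δ p (λ j → c (suc j))))
                            (C.+-identityˡ _)

  chartMatrix-independent :
    ∀ {k n} (J : k ⊑ n) a (c : Vector ℂ k) →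
    (∀ i → (chartMatrix J a · c) i ≈ 0#) → ∀ p → c p ≈ 0#
  chartMatrix-independent J a c Mc≈0 p = begin
    c p                                        ≈⟨ sum-δ p c ⟨
    sum (λ j → δ p j * c j)                    ≡⟨ sum-cong-≗ (λ j →
      ≡.cong (_* c j) (chartMatrix-elem J a p j)) ⟨
    (chartMatrix J a · c) (elem J p)           ≈⟨ Mc≈0 (elem J p) ⟩
    0#                                         ∎
    where
    open Sum C.semiring using (sum-cong-≗)
    open SetoidReasoning C.setoid

  chart : ∀ {k n} (J : k ⊑ n) → (Coord J → ℂ) → Gr k n
  chart J a = record
    { matrix      = chartMatrix J a
    ; independent = chartMatrix-independent J a
    }

  -- The ideal of Z in the coordinate ring of the chart of J.
  Ideal : ∀ {k n} → Pred (Gr k n) 0ℓ → (J : k ⊑ n) → Pred (Poly (Coord J)) 0ℓ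
  Ideal Z J f = ∀ a → chart J a ∈ Z → ⟦ f ⟧ a ≈ 0#

  -- f₀, …, fₘ₋₁ generate the localization of the ideal I at the point a.
  GenerateAt : ∀ {V m} → (V → ℂ) → Pred (Poly V) 0ℓ → (Fin m → Poly V) → Set
  GenerateAt {V} {m} a I f =
      (∀ r → f r ∈ I)
    × (∀ h → h ∈ I →
       ∃ λ g → ¬ (⟦ g ⟧ a ≈ 0#) ×
       ∃ λ (q : Fin m → Poly V) → ∀ x → ⟦ g ⟧ x * ⟦ h ⟧ x ≈ sum λ r → ⟦ q r ⟧ x * ⟦ f r ⟧ x)

  -- The rows of the Jacobian matrix of f₀, …, fₘ₋₁ at a are independent.
  FullRankJacobian : ∀ {V m} → DecidableEquality V →
                     (V → ℂ) → (Fin m → Poly V) → Set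
  FullRankJacobian {m = m} _≟_ a f =
    ∀ (c : Vector ℂ m) → (∀ v → sum (λ r → c r * ⟦ ∂ _≟_ v (f r) ⟧ a) ≈ 0#) → ∀ r → c r ≈ 0#

  -- Z, with its reduced structure, is smooth at the point a of the chart of J:
  -- near a its ideal is generated by m polynomials whose Jacobian matrix has
  -- rank m at a.
  SmoothAt : ∀ {k n} → Pred (Gr k n) 0ℓ → (J : k ⊑ n) → (Coord J → ℂ) → Set
  SmoothAt Z J a =
    ∃ λ m → ∃ λ (f : Fin m → Poly (Coord J)) →
      GenerateAt a (Ideal Z J) f × FullRankJacobian (_≟ᶜ_ {J = J}) a f

  Smooth : ∀ {k n} → Pred (Gr k n) 0ℓ → Set
  Smooth {k} {n} Z = ∀ (J : k ⊑ n) a → chart J a ∈ Z → SmoothAt Z J a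

  -- The coordinates of δ_J ∈ ℝⁿ.
  indicator : ∀ {k n} → k ⊑ n → Vector R.Carrier n
  indicator J i with position J i
  ... | inj₁ _ = R.1#
  ... | inj₂ _ = R.0#

  ∑⊑ : ∀ {k n} → (k ⊑ n → R.Carrier) → R.Carrier
  ∑⊑ {k} {n} f = foldr (λ J s → f J R.+ s) R.0# (allSubsets k n)

  μ : ∀ {k n} → Gr k n → Vector R.Carrier n
  μ X i = ∑⊑ (λ J → ∥ Plücker X J ∥² R.* indicator J i)
          R.* ∑⊑ (λ J → ∥ Plücker X J ∥²) R.⁻¹

  μ[_] : ∀ {k n} → Pred (Gr k n) 0ℓ → Pred (Vector R.Carrier n) 0ℓ
  μ[ Z ] v = ∃ λ X → X ∈ Z × (∀ i → v i R.≈ μ X i)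

{-# OPTIONS --safe #-}

-- The chart coordinates of X at a vertex J of its matroid polytope are scaled
-- by pairwise distinct characters of the torus, so a polynomial in the ideal of
-- the orbit closure has no linear term in a coordinate that is nonzero on X.
-- The coordinates that vanish on X do belong to the ideal.  Smoothness at the
-- fixed point of J and Nakayama's lemma then show that they generate the ideal
-- locally, so that the orbit closure contains every point of the chart whose
-- coordinates are supported where those of X are.  If Y has the same matroid
-- as X, then Y is such a point; hence the closure of TX contains that of TY,
-- and the converse holds by symmetry.  The matroid is recovered from the image
-- of the moment map as the set of those J with δ_J in the image.
module Submission where

open import Defs
open import Algebra.Bundles using (CommutativeRing)
import Algebra.Properties.CommutativeMonoid.Sum as CMSum
import Algebra.Properties.Group as GroupProperties
import Algebra.Properties.Ring as RingProperties
import Algebra.Properties.Semiring.Exp as Exp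
import Algebra.Properties.Semiring.Sum as Sum
import Algebra.Solver.Ring.NaturalCoefficients.Default as SemiringSolver
open import Data.Bool.Base using (if_then_else_)
open import Data.Fin.Base using (Fin; zero; suc; toℕ; punchIn; punchOut)
open import Data.Fin.Properties using (punchInᵢ≢i; punchIn-injective; punchIn-punchOut; any?) renaming (_≟_ to _≟ᶠ_)
open import Data.List.Base using (List; []; _∷_; length; map; foldr)
open import Data.List.Membership.Propositional using () renaming (_∈_ to _∈ᴸ_)
open import Data.List.Membership.Propositional.Properties using (∈-map⁺; ∈-++⁺ˡ; ∈-++⁺ʳ)
open import Data.List.Relation.Unary.All using (All; []; _∷_)
open import Data.List.Relation.Unary.Any using (here; there)
open import Data.Nat.Base using (ℕ; zero; suc; _≤_; s≤s; z≤n)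
import Data.Nat.Base as ℕ
open import Data.Nat.Properties using (m<n⇒m<1+n; n<1+n; <⇒≤; m≤n⇒m≤1+n; 1+n≰n; ≤-refl; ≤-reflexive; ≤-trans; m≤m⊔n; m≤n⊔m)
open import Data.Product.Base using (_×_; _,_; ∃; proj₁; proj₂)
open import Data.Sum.Base using (_⊎_; inj₁; inj₂; [_,_]′)
import Data.Sum.Base as ⊎
open import Data.Unit.Base using (⊤; tt)
open import Data.Vec.Functional using (Vector; tail; insertAt)
import Data.Vec.Functional as VF
open import Data.Vec.Functional.Properties using (insertAt-lookup; insertAt-punchIn)
open import Function.Base using (_∘_)
open import Level as Level using (_⊔_)
open import Relation.Binary.Definitions using (Decidable; DecidableEquality; tri<; tri≈; tri>)
open import Relation.Binary.PropositionalEquality.Core as ≡ using (_≡_; _≢_)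
import Relation.Binary.Reasoning.Setoid as SetoidReasoning
open import Relation.Binary.Structures using (IsStrictTotalOrder)
open import Relation.Nullary.Decidable using (Dec; yes; no; does; decidable-stable; ¬?; dec-true; dec-false; _×-dec_)
open import Relation.Nullary.Negation.Core using (¬_; contradiction)
open import Relation.Unary using (Pred; _∈_; _≐′_)

-- No local ring is formed. Nakayama's lemma is applied on the line s ↦ s b through the target point
-- b: there the coordinates that vanish on X are identically zero, and the relations g x_v = Σ q_r
-- f_r become a linear system Q(s) F(s) = 0 over polynomials in s with Q(0) injective. Factors s can
-- then be split off F without end, so F = 0. The same argument cancels a denominator g with g(0) ≠
-- 0 along the whole line, even where g vanishes; this carries information at the fixed point to
-- arbitrary points b of the chart.
--
-- Injectivity of Q(0) is where smoothness acts. Let D be the Jacobian matrix at the fixed point.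
-- Its columns at coordinates nonzero on X vanish, and Q(0), divided by the denominators, yields a
-- left inverse L of the rest. Thus D L D = D, and full rank cancels D on the right.
--
-- Polynomials are compared by values, so coefficients must be recovered from values at s ≠ 0. The
-- number 2 serves for this: as it is not a root of unity, p(2s) - p(s) loses the constant term and
-- nothing else.

data Adjacent : ∀ {k} → Fin k → Fin k → Set where
  base : ∀ {k} → Adjacent {suc (suc k)} zero (suc zero)
  step : ∀ {k} {p q : Fin k} → Adjacent p q → Adjacent (suc p) (suc q)

-- Alternating forms and determinants over a commutative ring.

module Determinants {c ℓ} (K : CommutativeRing c ℓ) where

  open CommutativeRing K hiding (zero)
  open RingProperties ring using (-1*x≈-x)
  open GroupProperties +-group using (inverseˡ-unique)
  open Sum semiring public
    using (sum; sum-cong-≋; ∑-distrib-+; ∑-comm; *-distribˡ-sum; *-distribʳ-sum; sum-replicate-zero)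
  open Exp semiring public using (_^_)
  open CMSum *-commutativeMonoid public using () renaming (sum to product)
  open SemiringSolver commutativeSemiring using (solve; _:=_; _:+_; _:*_)
  open SetoidReasoning setoid

  Matrix : Set → ℕ → Set c
  Matrix I k = I → Fin k → Carrier

  infixl 7 _⊙_
  infixr 5 _∷ᶜ_

  _∷ᶜ_ : ∀ {I k} → (I → Carrier) → Matrix I k → Matrix I (suc k)
  (a ∷ᶜ A) i = a i VF.∷ A i

  _⊙_ : ∀ {I m k} → Matrix I m → Matrix (Fin m) k → Matrix I k
  (A ⊙ B) i j = sum λ p → A i p * B p j

  minor : ∀ {k} → Fin (suc k) → Matrix (Fin (suc k)) (suc k) → Matrix (Fin k) k
  minor j A p q = A (suc p) (punchIn j q)

  det         : ∀ {k} → Matrix (Fin k) k → Carrier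
  laplaceTerm : ∀ {k} → Matrix (Fin (suc k)) (suc k) → Fin (suc k) → Carrier

  det {zero}  A = 1#
  det {suc k} A = sum (laplaceTerm A)
  laplaceTerm A j = (- 1#) ^ toℕ j * A zero j * det (minor j A)

  sum-0 : ∀ {k} {f : Vector Carrier k} → (∀ i → f i ≈ 0#) → sum f ≈ 0#
  sum-0 {k} f≈0 = trans (sum-cong-≋ f≈0) (sum-replicate-zero k)

  sum-single : ∀ {k} (f : Vector Carrier k) i → (∀ j → j ≢ i → f j ≈ 0#) → sum f ≈ f i
  sum-single f zero    f≈0 = trans (+-congˡ (sum-0 (λ j → f≈0 (suc j) λ ()))) (+-identityʳ _)
  sum-single f (suc i) f≈0 = trans (+-cong (f≈0 zero λ ())
      (sum-single (tail f) i λ j j≢i → f≈0 (suc j) λ { ≡.refl → j≢i ≡.refl }))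
    (+-identityˡ _)

  -- The vector space is the space of functions I → Carrier, and the arguments
  -- of the form are the columns of a matrix.
  record IsAlternating {I k} (D : Matrix I k → Carrier) : Set (c ⊔ ℓ) where
    field
      cong        : ∀ {A B} → (∀ i j → A i j ≈ B i j) → D A ≈ D B
      linear      : ∀ j x y {A B C} → (∀ i → A i j ≈ x * B i j + y * C i j) →
                    (∀ i p → p ≢ j → A i p ≈ B i p) →
                    (∀ i p → p ≢ j → A i p ≈ C i p) →
                    D A ≈ x * D B + y * D C
      alternating : ∀ {p q} → Adjacent p q → ∀ A → (∀ i → A i p ≈ A i q) → D A ≈ 0#

  open IsAlternating

  -- Freezing the first argument gives a form in one argument fewer; the inductions on the number of
  -- columns below recurse into it.
  ∷ᶜ-isAlternating : ∀ {I k} {D : Matrix I (suc k) → Carrier} → IsAlternating D →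
                     ∀ a → IsAlternating λ A → D (a ∷ᶜ A)
  ∷ᶜ-isAlternating alt a = record
    { cong        = λ e → cong alt λ { i zero → refl ; i (suc j) → e i j }
    ; linear      = λ j x y e f g → linear alt (suc j) x y e
        (λ { i zero _ → refl ; i (suc p) p≢j → f i p (λ { ≡.refl → p≢j ≡.refl }) })
        (λ { i zero _ → refl ; i (suc p) p≢j → g i p (λ { ≡.refl → p≢j ≡.refl }) })
    ; alternating = λ adj A e → alternating alt (step adj) (a ∷ᶜ A) e
    }

  det-cong : ∀ {k} {A B : Matrix (Fin k) k} → (∀ i j → A i j ≈ B i j) → det A ≈ det B
  det-cong {zero}  e = refl
  det-cong {suc k} {A} {B} e = sum-cong-≋ {x = laplaceTerm A} {y = laplaceTerm B} λ j →
    *-cong (*-congˡ (e zero j)) (det-cong λ p q → e (suc p) (punchIn j q))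

  -- In the Laplace term of column j the entry is linear and the minor is unchanged; in every other
  -- term it is the other way round, with column j found at its punched-out position.
  det-linear : ∀ {k} j x y {A B C : Matrix (Fin k) k} →
    (∀ i → A i j ≈ x * B i j + y * C i j) →
    (∀ i p → p ≢ j → A i p ≈ B i p) → (∀ i p → p ≢ j → A i p ≈ C i p) →
    det A ≈ x * det B + y * det C
  det-linear {suc k} j x y {A} {B} {C} e f g = begin
    sum (term A)                                           ≈⟨ sum-cong-≋ split ⟩
    sum (λ p → x * term B p + y * term C p)                ≈⟨ ∑-distrib-+ (λ p → x * term B p) (λ p → y * term C p) ⟩
    sum (λ p → x * term B p) + sum (λ p → y * term C p)    ≈⟨ +-cong (*-distribˡ-sum x (term B)) (*-distribˡ-sum y (term C)) ⟨
    x * det B + y * det C                                  ∎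
    where
    term = laplaceTerm

    split : ∀ p → term A p ≈ x * term B p + y * term C p
    split p with p ≟ᶠ j
    ... | yes ≡.refl = begin
      s * A zero p * det (minor p A)
        ≈⟨ *-congʳ (*-congˡ (e zero)) ⟩
      s * (x * B zero p + y * C zero p) * det (minor p A)
        ≈⟨ solve 6 (λ s x y b c d → s :* (x :* b :+ y :* c) :* d := x :* (s :* b :* d) :+ y :* (s :* c :* d)) refl s x y (B zero p) (C zero p) (det (minor p A)) ⟩
      x * (s * B zero p * det (minor p A)) + y * (s * C zero p * det (minor p A))
        ≈⟨ +-cong (*-congˡ (*-congˡ (det-cong λ i q → f (suc i) _ (punchInᵢ≢i p q))))
                  (*-congˡ (*-congˡ (det-cong λ i q → g (suc i) _ (punchInᵢ≢i p q)))) ⟩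
      x * term B p + y * term C p ∎
      where s = (- 1#) ^ toℕ p
    ... | no p≢j = begin
      s * A zero p * det (minor p A)
        ≈⟨ *-congˡ (det-linear q x y
             (λ i → ≡.subst (λ r → A (suc i) r ≈ x * B (suc i) r + y * C (suc i) r) (≡.sym q≡j) (e (suc i)))
             (λ i r r≢q → f (suc i) _ (r≢q ∘ other))
             (λ i r r≢q → g (suc i) _ (r≢q ∘ other))) ⟩
      s * A zero p * (x * det (minor p B) + y * det (minor p C))
        ≈⟨ solve 6 (λ s a x y b c → s :* a :* (x :* b :+ y :* c) := x :* (s :* a :* b) :+ y :* (s :* a :* c)) refl s (A zero p) x y (det (minor p B)) (det (minor p C)) ⟩
      x * (s * A zero p * det (minor p B)) + y * (s * A zero p * det (minor p C))
        ≈⟨ +-cong (*-congˡ (*-congʳ (*-congˡ (f zero p p≢j)))) (*-congˡ (*-congʳ (*-congˡ (g zero p p≢j)))) ⟩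
      x * term B p + y * term C p ∎
      where
      s = (- 1#) ^ toℕ p
      q = punchOut p≢j
      q≡j = punchIn-punchOut p≢j
      other : ∀ {r} → punchIn p r ≡ j → r ≡ q
      other {r} r≡j = punchIn-injective p r q (≡.trans r≡j (≡.sym q≡j))

  sum-adjacent : ∀ {k} {p q : Fin k} (f : Vector Carrier k) → Adjacent p q →
                 f p + f q ≈ 0# → (∀ r → r ≢ p → r ≢ q → f r ≈ 0#) → sum f ≈ 0#
  sum-adjacent f base     e z = begin
    f zero + (f (suc zero) + sum (tail (tail f)))
      ≈⟨ +-assoc _ _ _ ⟨
    f zero + f (suc zero) + sum (tail (tail f))
      ≈⟨ +-cong e (sum-0 λ i → z (suc (suc i)) (λ ()) (λ ())) ⟩
    0# + 0#
      ≈⟨ +-identityˡ 0# ⟩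
    0# ∎
  sum-adjacent f (step a) e z = trans
    (+-cong (z zero (λ ()) (λ ())) (sum-adjacent (tail f) a e
      λ r r≢p r≢q → z (suc r) (λ { ≡.refl → r≢p ≡.refl }) (λ { ≡.refl → r≢q ≡.refl })))
    (+-identityˡ 0#)

  adjacent-toℕ : ∀ {k} {p q : Fin k} → Adjacent p q → toℕ q ≡ suc (toℕ p)
  adjacent-toℕ base     = ≡.refl
  adjacent-toℕ (step a) = ≡.cong suc (adjacent-toℕ a)

  adjacent-punchOut : ∀ {k} {p q : Fin (suc k)} → Adjacent p q → ∀ r → r ≢ p → r ≢ q →
    ∃ λ p′ → ∃ λ q′ → Adjacent p′ q′ × punchIn r p′ ≡ p × punchIn r q′ ≡ q
  adjacent-punchOut base zero r≢p _ = contradiction ≡.refl r≢p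
  adjacent-punchOut base (suc zero) _ r≢q = contradiction ≡.refl r≢q
  adjacent-punchOut {suc (suc k)} base (suc (suc r)) _ _ = zero , suc zero , base , ≡.refl , ≡.refl
  adjacent-punchOut (step {p = p} {q} a) zero _ _ = p , q , a , ≡.refl , ≡.refl
  adjacent-punchOut {suc k} (step a) (suc r) r≢p r≢q
    with p′ , q′ , a′ , e , f ← adjacent-punchOut a r (r≢p ∘ ≡.cong suc) (r≢q ∘ ≡.cong suc)
    = suc p′ , suc q′ , step a′ , ≡.cong suc e , ≡.cong suc f

  punchIn-adjacent : ∀ {k} {p q : Fin (suc k)} → Adjacent p q → ∀ r →
    (punchIn p r ≡ punchIn q r) ⊎ (punchIn p r ≡ q × punchIn q r ≡ p)
  punchIn-adjacent base     zero    = inj₂ (≡.refl , ≡.refl)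
  punchIn-adjacent base     (suc r) = inj₁ ≡.refl
  punchIn-adjacent (step a) zero    = inj₁ ≡.refl
  punchIn-adjacent (step a) (suc r) with punchIn-adjacent a r
  ... | inj₁ e       = inj₁ (≡.cong suc e)
  ... | inj₂ (e , f) = inj₂ (≡.cong suc e , ≡.cong suc f)

  -- The two Laplace terms at p and q have the same minor and opposite signs. In all other terms the
  -- equal columns survive and are still neighbours, so induction applies. Restricting to neighbours
  -- avoids tracking the sign of a longer move.
  det-alternating : ∀ {k} {p q : Fin k} → Adjacent p q → ∀ A → (∀ i → A i p ≈ A i q) → det A ≈ 0#
  det-alternating {suc k} {p} {q} adj A e = sum-adjacent term adj cancel vanish
    where
    term = laplaceTerm A

    vanish : ∀ r → r ≢ p → r ≢ q → term r ≈ 0#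
    vanish r r≢p r≢q with p′ , q′ , adj′ , ≡.refl , ≡.refl ← adjacent-punchOut adj r r≢p r≢q =
      trans (*-congˡ (det-alternating adj′ (minor r A) (e ∘ suc))) (zeroʳ _)

    same : ∀ i r → A (suc i) (punchIn q r) ≈ A (suc i) (punchIn p r)
    same i r with punchIn-adjacent adj r
    ... | inj₁ f       = reflexive (≡.cong (A (suc i)) (≡.sym f))
    ... | inj₂ (f , g) = begin
      A (suc i) (punchIn q r) ≡⟨ ≡.cong (A (suc i)) g ⟩
      A (suc i) p             ≈⟨ e (suc i) ⟩
      A (suc i) q             ≡⟨ ≡.cong (A (suc i)) f ⟨
      A (suc i) (punchIn p r) ∎

    cancel : term p + term q ≈ 0#
    cancel = begin
      s * A zero p * d + (- 1#) ^ toℕ q * A zero q * det (minor q A)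
        ≈⟨ +-congˡ (*-cong (*-cong (reflexive (≡.cong ((- 1#) ^_) (adjacent-toℕ adj))) (sym (e zero))) (det-cong same)) ⟩
      s * A zero p * d + - 1# * s * A zero p * d
        ≈⟨ +-cong (sym (*-identityˡ _)) (trans (*-congʳ (*-assoc _ _ _)) (*-assoc _ _ _)) ⟩
      1# * (s * A zero p * d) + - 1# * (s * A zero p * d)
        ≈⟨ distribʳ _ _ _ ⟨
      (1# + - 1#) * (s * A zero p * d)
        ≈⟨ trans (*-congʳ (-‿inverseʳ 1#)) (zeroˡ _) ⟩
      0# ∎
      where
      s = (- 1#) ^ toℕ p
      d = det (minor p A)

  det-isAlternating : ∀ {k} → IsAlternating (det {k})
  det-isAlternating = record
    { cong = det-cong ; linear = det-linear ; alternating = det-alternating }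

  module _ {I : Set} where

    linear₀ : ∀ {k} {D : Matrix I (suc k) → Carrier} → IsAlternating D → ∀ x y a b A →
              D ((λ i → x * a i + y * b i) ∷ᶜ A) ≈ x * D (a ∷ᶜ A) + y * D (b ∷ᶜ A)
    linear₀ alt x y a b A = linear alt zero x y (λ _ → refl)
      (λ { i zero 0≢0 → contradiction ≡.refl 0≢0 ; i (suc p) _ → refl })
      (λ { i zero 0≢0 → contradiction ≡.refl 0≢0 ; i (suc p) _ → refl })

    -- Polarisation: the form vanishes on (a + b, a + b, ...), and so do the terms with a or b
    -- repeated; the two mixed terms remain.
    swap : ∀ {k} {D : Matrix I (suc (suc k)) → Carrier} → IsAlternating D → ∀ a b A →
           D (a ∷ᶜ b ∷ᶜ A) ≈ - 1# * D (b ∷ᶜ a ∷ᶜ A)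
    swap {D = D} alt a b A = trans (inverseˡ-unique _ _ (begin
      D (a ∷ᶜ b ∷ᶜ A) + D (b ∷ᶜ a ∷ᶜ A)
        ≈⟨ +-cong (+-identityˡ _) (+-identityʳ _) ⟨
      (0# + D (a ∷ᶜ b ∷ᶜ A)) + (D (b ∷ᶜ a ∷ᶜ A) + 0#)
        ≈⟨ +-cong (+-congʳ (repeat a)) (+-congˡ (repeat b)) ⟨
      (D (a ∷ᶜ a ∷ᶜ A) + D (a ∷ᶜ b ∷ᶜ A)) + (D (b ∷ᶜ a ∷ᶜ A) + D (b ∷ᶜ b ∷ᶜ A))
        ≈⟨ +-cong (+-cong (one _) (one _)) (+-cong (one _) (one _)) ⟨
      (1# * D (a ∷ᶜ a ∷ᶜ A) + 1# * D (a ∷ᶜ b ∷ᶜ A)) + (1# * D (b ∷ᶜ a ∷ᶜ A) + 1# * D (b ∷ᶜ b ∷ᶜ A))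
        ≈⟨ +-cong (linear₀ (∷ᶜ-isAlternating alt a) 1# 1# a b A) (linear₀ (∷ᶜ-isAlternating alt b) 1# 1# a b A) ⟨
      D (a ∷ᶜ ab ∷ᶜ A) + D (b ∷ᶜ ab ∷ᶜ A)
        ≈⟨ +-cong (one _) (one _) ⟨
      1# * D (a ∷ᶜ ab ∷ᶜ A) + 1# * D (b ∷ᶜ ab ∷ᶜ A)
        ≈⟨ linear₀ alt 1# 1# a b (ab ∷ᶜ A) ⟨
      D (ab ∷ᶜ ab ∷ᶜ A)
        ≈⟨ repeat ab ⟩
      0# ∎)) (sym (-1*x≈-x _))
      where
      one = *-identityˡ
      ab : I → Carrier
      ab i = 1# * a i + 1# * b i
      repeat : ∀ c → D (c ∷ᶜ c ∷ᶜ A) ≈ 0#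
      repeat c = alternating alt base (c ∷ᶜ c ∷ᶜ A) (λ _ → refl)

    delete : ∀ {k} → Fin (suc k) → Matrix I (suc k) → Matrix I k
    delete j A i p = A i (punchIn j p)

    uncons : ∀ {k} (A : Matrix I (suc k)) i j → ((λ i → A i zero) ∷ᶜ (λ i → A i ∘ suc)) i j ≈ A i j
    uncons A i zero    = refl
    uncons A i (suc j) = refl

    -- A rank-one update of C. Terms in which a occurs twice vanish, so at most one column of C is
    -- replaced by a multiple of a, and bringing that column to the front costs the sign (- 1)^j.
    expand : ∀ {k} {D : Matrix I (suc k) → Carrier} → IsAlternating D → ∀ a (b : Vector Carrier (suc k)) C →
      D (λ i j → C i j + a i * b j) ≈ D C + sum (λ j → b j * ((- 1#) ^ toℕ j * D (a ∷ᶜ delete j C)))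
    expand {zero} {D} alt a b C = begin
      D (λ i j → C i j + a i * b j)
        ≈⟨ linear alt zero 1# (b zero) {B = C} {C = a ∷ᶜ delete zero C}
             (λ i → +-cong (sym (*-identityˡ _)) (*-comm _ _))
             (λ { i zero 0≢0 → contradiction ≡.refl 0≢0 })
             (λ { i zero 0≢0 → contradiction ≡.refl 0≢0 }) ⟩
      1# * D C + b zero * D (a ∷ᶜ delete zero C)
        ≈⟨ +-cong (*-identityˡ _) (trans (sym (*-congˡ (*-identityˡ _))) (sym (+-identityʳ _))) ⟩
      D C + (b zero * (1# * D (a ∷ᶜ delete zero C)) + 0#) ∎
    expand {suc k} {D} alt a b C = begin
      D (λ i j → C i j + a i * b j)
        ≈⟨ cong alt (λ { i zero → +-cong (sym (*-identityˡ _)) (*-comm _ _) ; i (suc j) → refl }) ⟩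
      D ((λ i → 1# * c₀ i + b zero * a i) ∷ᶜ C⁺)
        ≈⟨ linear₀ alt 1# (b zero) c₀ a C⁺ ⟩
      1# * D (c₀ ∷ᶜ C⁺) + b zero * D (a ∷ᶜ C⁺)
        ≈⟨ +-cong (trans (*-identityˡ _) (expand (∷ᶜ-isAlternating alt c₀) a (tail b) C′)) (*-congˡ keep) ⟩
      D (c₀ ∷ᶜ C′) + S + b zero * D (a ∷ᶜ C′)
        ≈⟨ +-assoc _ _ _ ⟩
      D (c₀ ∷ᶜ C′) + (S + b zero * D (a ∷ᶜ C′))
        ≈⟨ +-cong (cong alt (uncons C)) (+-comm _ _) ⟩
      D C + (b zero * D (a ∷ᶜ C′) + S)
        ≈⟨ +-congˡ (+-cong (*-congˡ (sym (*-identityˡ _))) (sum-cong-≋ {x = before} {y = after} λ j → *-congˡ (move j))) ⟩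
      D C + sum (λ j → b j * ((- 1#) ^ toℕ j * D (a ∷ᶜ delete j C))) ∎
      where
      c₀ : I → Carrier
      c₀ i = C i zero
      C′ C⁺ : Matrix I (suc k)
      C′ i j = C i (suc j)
      C⁺ i j = C i (suc j) + a i * b (suc j)
      before after : Fin (suc k) → Carrier
      before j = b (suc j) * ((- 1#) ^ toℕ j * D (c₀ ∷ᶜ a ∷ᶜ delete j C′))
      after j = b (suc j) * (- 1# * (- 1#) ^ toℕ j * D (a ∷ᶜ delete (suc j) C))
      S = sum before

      keep : D (a ∷ᶜ C⁺) ≈ D (a ∷ᶜ C′)
      keep = trans (expand (∷ᶜ-isAlternating alt a) a (tail b) C′) (trans (+-congˡ (sum-0 {f = λ j → b (suc j) * ((- 1#) ^ toℕ j * D (a ∷ᶜ a ∷ᶜ delete j C′))} λ j →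
        trans (*-congˡ (trans (*-congˡ (alternating alt base (a ∷ᶜ a ∷ᶜ delete j C′) λ _ → refl)) (zeroʳ _))) (zeroʳ _)))
        (+-identityʳ _))

      move : ∀ j → (- 1#) ^ toℕ j * D (c₀ ∷ᶜ a ∷ᶜ delete j C′) ≈ - 1# * (- 1#) ^ toℕ j * D (a ∷ᶜ delete (suc j) C)
      move j = begin
        s * D (c₀ ∷ᶜ a ∷ᶜ delete j C′)          ≈⟨ *-congˡ (swap alt c₀ a _) ⟩
        s * (- 1# * D (a ∷ᶜ c₀ ∷ᶜ delete j C′)) ≈⟨ solve 3 (λ s n d → s :* (n :* d) := n :* s :* d) refl s (- 1#) _ ⟩
        - 1# * s * D (a ∷ᶜ c₀ ∷ᶜ delete j C′)   ≈⟨ *-congˡ (cong alt λ { i zero → refl ; i (suc zero) → refl ; i (suc (suc p)) → refl }) ⟩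
        - 1# * s * D (a ∷ᶜ delete (suc j) C)    ∎
        where s = (- 1#) ^ toℕ j

    -- The product A B is the rank-one product of the first column of A with the first row of B,
    -- added to the product of what remains; `expand` applies to this update.
    ⊙-expand : ∀ {m k} {D : Matrix I (suc k) → Carrier} → IsAlternating D →
      ∀ (A : Matrix I (suc m)) (B : Matrix (Fin (suc m)) (suc k)) →
      let A′ = λ i → A i ∘ suc in
      D (A ⊙ B) ≈ D (A′ ⊙ (B ∘ suc)) + sum (λ j → B zero j * ((- 1#) ^ toℕ j *
                    D ((λ i → A i zero) ∷ᶜ (A′ ⊙ (λ p q → B (suc p) (punchIn j q))))))
    ⊙-expand alt A B = trans (cong alt λ i j → +-comm _ _)
      (expand alt (λ i → A i zero) (B zero) ((λ i → A i ∘ suc) ⊙ (B ∘ suc)))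

    -- The k columns are combinations of fewer than k vectors. Expanding along a column of A lowers
    -- m, and k as well whenever that column is frozen, so m < k persists.
    ⊙-degenerate : ∀ {m k} {D : Matrix I k → Carrier} → IsAlternating D → m ℕ.< k →
      ∀ (A : Matrix I m) B → D (A ⊙ B) ≈ 0#
    ⊙-degenerate {zero} {suc k} alt _ A B =
      -- An empty product is the zero matrix, whose first column is 0 times itself plus 0 times
      -- itself.
      trans (linear alt zero 0# 0# (λ i → sym (trans (+-cong (zeroˡ 0#) (zeroˡ 0#)) (+-identityˡ 0#)))
        (λ _ _ _ → refl) (λ _ _ _ → refl))
      (trans (+-cong (zeroˡ _) (zeroˡ _)) (+-identityˡ 0#))
    ⊙-degenerate {suc m} {suc k} {D} alt (s≤s m<k) A B =
      trans (⊙-expand alt A B) (trans (+-cong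
        (⊙-degenerate alt (m<n⇒m<1+n m<k) _ _)
        (sum-0 {f = λ j → B zero j * ((- 1#) ^ toℕ j * D ((λ i → A i zero) ∷ᶜ
                    ((λ i → A i ∘ suc) ⊙ (λ p q → B (suc p) (punchIn j q)))))} λ j → trans (*-congˡ (trans (*-congˡ
          (⊙-degenerate (∷ᶜ-isAlternating alt _) m<k _ _)) (zeroʳ _))) (zeroʳ _)))
        (+-identityˡ 0#))

    -- Multiplicativity of the determinant. It is stated for every alternating form because the
    -- induction freezes a column of A and thereby changes the form. By `⊙-degenerate` the term
    -- without that column vanishes, and the others assemble into the Laplace expansion of `det B`.
    ⊙-det : ∀ {k} {D : Matrix I k → Carrier} → IsAlternating D → ∀ A B → D (A ⊙ B) ≈ D A * det B
    ⊙-det {zero}  alt A B = trans (cong alt λ _ ()) (sym (*-identityʳ _))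
    ⊙-det {suc k} {D} alt A B = begin
      D (A ⊙ B)
        ≈⟨ ⊙-expand alt A B ⟩
      D (A′ ⊙ (B ∘ suc)) + sum (λ j → B zero j * ((- 1#) ^ toℕ j * D (a ∷ᶜ (A′ ⊙ minor j B))))
        ≈⟨ trans (+-congʳ (⊙-degenerate alt (n<1+n k) A′ (B ∘ suc))) (+-identityˡ _) ⟩
      sum (λ j → B zero j * ((- 1#) ^ toℕ j * D (a ∷ᶜ (A′ ⊙ minor j B))))
        ≈⟨ sum-cong-≋ {x = λ j → B zero j * ((- 1#) ^ toℕ j * D (a ∷ᶜ (A′ ⊙ minor j B)))} {y = λ j → D A * laplaceTerm B j}
             (λ j → trans (*-congˡ (*-congˡ (trans (⊙-det (∷ᶜ-isAlternating alt a) A′ (minor j B)) (*-congʳ (cong alt (uncons A))))))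
             (solve 4 (λ b s d e → b :* (s :* (d :* e)) := d :* (s :* b :* e)) refl (B zero j) ((- 1#) ^ toℕ j) (D A) (det (minor j B)))) ⟩
      sum (λ j → D A * laplaceTerm B j)
        ≈⟨ *-distribˡ-sum (D A) (laplaceTerm B) ⟨
      D A * det B ∎
      where
      a : I → Carrier
      a i = A i zero
      A′ : Matrix I k
      A′ i j = A i (suc j)

  det-scale-rows : ∀ {k} (t : Vector Carrier k) A → det (λ i j → t i * A i j) ≈ product t * det A
  det-scale-rows {zero}  t A = sym (*-identityˡ _)
  det-scale-rows {suc k} t A = trans (sum-cong-≋ {x = laplaceTerm (λ i j → t i * A i j)} {y = λ j → product t * laplaceTerm A j} λ j → trans
      (*-congˡ (det-scale-rows (tail t) (minor j A)))
      (solve 5 (λ s t a p d → s :* (t :* a) :* (p :* d) := t :* p :* (s :* a :* d)) refl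
        ((- 1#) ^ toℕ j) (t zero) (A zero j) (product (tail t)) (det (minor j A))))
    (sym (*-distribˡ-sum (product t) (laplaceTerm A)))

  product-0 : ∀ {k} (t : Vector Carrier k) i → t i ≈ 0# → product t ≈ 0#
  product-0 t zero    e = trans (*-congʳ e) (zeroˡ _)
  product-0 t (suc i) e = trans (*-congˡ (product-0 (tail t) i e)) (zeroʳ _)

-- Linear algebra over a field with decidable equality.

⊑⇒≤ : ∀ {k n} → k ⊑ n → k ≤ n
⊑⇒≤ done     = z≤n
⊑⇒≤ (take J) = s≤s (⊑⇒≤ J)
⊑⇒≤ (skip J) = m≤n⇒m≤1+n (⊑⇒≤ J)

record DecidableField c ℓ : Set (Level.suc (c ⊔ ℓ)) where
  field
    commutativeRing : CommutativeRing c ℓ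

  open CommutativeRing commutativeRing public

  infix 4 _≟_

  field
    _≟_     : Decidable _≈_
    0≉1     : ¬ 0# ≈ 1#
    inverse : ∀ x → ¬ x ≈ 0# → ∃ λ y → x * y ≈ 1#

module LinearAlgebra {c ℓ} (F : DecidableField c ℓ) where

  open DecidableField F hiding (zero)
  open Determinants commutativeRing public
  open RingProperties ring using (-‿distribˡ-*; -‿distribʳ-*)
  open GroupProperties +-group using (x∙y⁻¹≈ε⇒x≈y; inverseʳ-unique)
  open CMSum +-commutativeMonoid using (sum-remove)
  open SemiringSolver commutativeSemiring using (solve; _:=_; _:+_; _:*_)
  open SetoidReasoning setoid

  x*y≈0⇒y≈0 : ∀ {x y} → ¬ x ≈ 0# → x * y ≈ 0# → y ≈ 0#
  x*y≈0⇒y≈0 {x} {y} x≉0 xy≈0 with z , xz≈1 ← inverse x x≉0 = begin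
    y           ≈⟨ *-identityˡ y ⟨
    1# * y      ≈⟨ *-congʳ xz≈1 ⟨
    x * z * y   ≈⟨ solve 3 (λ x y z → x :* z :* y := z :* (x :* y)) refl x y z ⟩
    z * (x * y) ≈⟨ *-congˡ xy≈0 ⟩
    z * 0#      ≈⟨ zeroʳ z ⟩
    0#          ∎

  δ : ∀ {k} → Fin k → Fin k → Carrier
  δ i j = if does (i ≟ᶠ j) then 1# else 0#

  δ-refl : ∀ {k} (i : Fin k) → δ i i ≈ 1#
  δ-refl i rewrite dec-true (i ≟ᶠ i) ≡.refl = refl

  δ-≢ : ∀ {k} {i j : Fin k} → i ≢ j → δ i j ≈ 0#
  δ-≢ {i = i} {j} i≢j rewrite dec-false (i ≟ᶠ j) i≢j = refl

  sum-δ : ∀ {k} (f : Vector Carrier k) i → sum (λ p → f p * δ p i) ≈ f i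
  sum-δ f i = trans
    (sum-single (λ p → f p * δ p i) i λ j j≢i → trans (*-congˡ (δ-≢ j≢i)) (zeroʳ _))
    (trans (*-congˡ (δ-refl i)) (*-identityʳ _))

  sum-δˡ : ∀ {k} (f : Vector Carrier k) i → sum (λ p → δ i p * f p) ≈ f i
  sum-δˡ f i = trans
    (sum-single (λ p → δ i p * f p) i λ j j≢i → trans (*-congʳ (δ-≢ (j≢i ∘ ≡.sym))) (zeroˡ _))
    (trans (*-congʳ (δ-refl i)) (*-identityˡ _))

  ⊙-assoc : ∀ {I l m k} (A : Matrix I l) (B : Matrix (Fin l) m) (C : Matrix (Fin m) k) i j →
            ((A ⊙ B) ⊙ C) i j ≈ (A ⊙ (B ⊙ C)) i j
  ⊙-assoc A B C i j = begin
    sum (λ q → sum (λ p → A i p * B p q) * C q j)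
      ≈⟨ sum-cong-≋ (λ q → *-distribʳ-sum (C q j) (λ p → A i p * B p q)) ⟩
    sum (λ q → sum (λ p → A i p * B p q * C q j))
      ≈⟨ ∑-comm (λ q p → A i p * B p q * C q j) ⟩
    sum (λ p → sum (λ q → A i p * B p q * C q j))
      ≈⟨ sum-cong-≋ (λ p → sum-cong-≋ (λ q → *-assoc (A i p) (B p q) (C q j))) ⟩
    sum (λ p → sum (λ q → A i p * (B p q * C q j)))
      ≈⟨ sum-cong-≋ (λ p → *-distribˡ-sum (A i p) (λ q → B p q * C q j)) ⟨
    sum (λ p → A i p * sum (λ q → B p q * C q j)) ∎

  -- Multiplying row i by 0 changes nothing, and `det-scale-rows` extracts the factor 0.
  det-zero-row : ∀ {k} (A : Matrix (Fin k) k) i → (∀ j → A i j ≈ 0#) → det A ≈ 0#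
  det-zero-row A i A≈0 = begin
    det A                            ≈⟨ det-cong same ⟩
    det (λ p q → mask p * A p q)     ≈⟨ det-scale-rows mask A ⟩
    product mask * det A             ≈⟨ *-congʳ (product-0 mask i mask-i) ⟩
    0# * det A                       ≈⟨ zeroˡ _ ⟩
    0#                               ∎
    where
    mask : Fin _ → Carrier
    mask p = if does (p ≟ᶠ i) then 0# else 1#
    mask-i : mask i ≈ 0#
    mask-i rewrite dec-true (i ≟ᶠ i) ≡.refl = refl
    same : ∀ p q → A p q ≈ mask p * A p q
    same p q with p ≟ᶠ i
    ... | yes ≡.refl = trans (A≈0 q) (sym (zeroˡ _))
    ... | no  _      = sym (*-identityˡ _)

  -- If c j ≉ 0 then A = A ⊙ B for a matrix B whose j-th row vanishes.
  alternating-kernel : ∀ {I k} {D : Matrix I k → Carrier} → IsAlternating D →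
    ∀ A → ¬ D A ≈ 0# → ∀ (c : Vector Carrier k) →
    (∀ i → sum (λ p → A i p * c p) ≈ 0#) → ∀ j → c j ≈ 0#
  alternating-kernel {I} {k} {D} alt A DA≉0 c Ac≈0 j with c j ≟ 0#
  ... | yes cj≈0 = cj≈0
  ... | no  cj≉0 with y , cy≈1 ← inverse (c j) cj≉0 = contradiction DA≈0 DA≉0
    where
    B : Matrix (Fin k) k
    B p q = δ p q + c p * (y * - δ j q)

    B-row : ∀ q → B j q ≈ 0#
    B-row q = begin
      δ j q + c j * (y * - δ j q)  ≈⟨ +-congˡ (*-assoc _ _ _) ⟨
      δ j q + c j * y * - δ j q    ≈⟨ +-congˡ (trans (*-congʳ cy≈1) (*-identityˡ _)) ⟩
      δ j q + - δ j q              ≈⟨ -‿inverseʳ _ ⟩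
      0#                           ∎

    A⊙B : ∀ i q → A i q ≈ (A ⊙ B) i q
    A⊙B i q = sym (begin
      sum (λ p → A i p * (δ p q + c p * z))
        ≈⟨ sum-cong-≋ {y = λ p → A i p * δ p q + A i p * c p * z} (λ p →
             trans (distribˡ _ _ _) (+-congˡ (sym (*-assoc _ _ _)))) ⟩
      sum (λ p → A i p * δ p q + A i p * c p * z)
        ≈⟨ ∑-distrib-+ (λ p → A i p * δ p q) (λ p → A i p * c p * z) ⟩
      sum (λ p → A i p * δ p q) + sum (λ p → A i p * c p * z)
        ≈⟨ +-cong (sum-δ (A i) q) (sym (*-distribʳ-sum z (λ p → A i p * c p))) ⟩
      A i q + sum (λ p → A i p * c p) * z
        ≈⟨ +-congˡ (trans (*-congʳ (Ac≈0 i)) (zeroˡ z)) ⟩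
      A i q + 0#
        ≈⟨ +-identityʳ _ ⟩
      A i q ∎)
      where z = y * - δ j q

    DA≈0 : D A ≈ 0#
    DA≈0 = begin
      D A           ≈⟨ IsAlternating.cong alt A⊙B ⟩
      D (A ⊙ B)     ≈⟨ ⊙-det alt A B ⟩
      D A * det B   ≈⟨ *-congˡ (det-zero-row B j B-row) ⟩
      D A * 0#      ≈⟨ zeroʳ _ ⟩
      0#            ∎

  HasKernel : ∀ {I k} → Matrix I k → Set _
  HasKernel {I} {k} A = ∃ λ (c : Vector Carrier k) →
    (∃ λ j → ¬ c j ≈ 0#) × (∀ i → sum (λ j → A i j * c j) ≈ 0#)

  minorAt : ∀ {k n} → Matrix (Fin n) k → k ⊑ n → Carrier
  minorAt A J = det λ p → A (elem J p)

  -- Column elimination with the pivot A zero j: `reduced` drops column j after adding multiples of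
  -- it to the other columns so as to clear row zero.
  module Pivot {k n} (A : Matrix (Fin (suc n)) (suc k)) (j : Fin (suc k))
    (A₀ⱼ≉0 : ¬ A zero j ≈ 0#) where

    A₀ⱼ⁻¹ : Carrier
    A₀ⱼ⁻¹ = proj₁ (inverse (A zero j) A₀ⱼ≉0)

    r : Vector Carrier k
    r q = - (A₀ⱼ⁻¹ * A zero (punchIn j q))

    reduced : Matrix (Fin (suc n)) k
    reduced i q = A i (punchIn j q) + A i j * r q

    reduced-zero : ∀ q → reduced zero q ≈ 0#
    reduced-zero q = begin
      x + A zero j * - (A₀ⱼ⁻¹ * x)  ≈⟨ +-congˡ (-‿distribʳ-* _ _) ⟨
      x + - (A zero j * (A₀ⱼ⁻¹ * x)) ≈⟨ +-congˡ (-‿cong (trans (sym (*-assoc _ _ _)) (trans (*-congʳ (proj₂ (inverse (A zero j) A₀ⱼ≉0))) (*-identityˡ _)))) ⟩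
      x + - x                        ≈⟨ -‿inverseʳ x ⟩
      0#                             ∎
      where x = A zero (punchIn j q)

    kernel : HasKernel (reduced ∘ suc) → HasKernel A
    kernel (c , (q , cq≉0) , e) = c̃
      , (punchIn j q , λ c̃≈0 → cq≉0 (trans (reflexive (≡.sym (insertAt-punchIn c j s q))) c̃≈0))
      , λ i → trans (value i) (zeros i)
      where
      -- The total multiple of column j that the elimination has added, so that A applied to `c̃`
      -- equals `reduced` applied to c.
      s = sum λ q → r q * c q
      c̃ = insertAt c j s

      value : ∀ i → sum (λ p → A i p * c̃ p) ≈ sum (λ q → reduced i q * c q)
      value i = begin
        sum (λ p → A i p * c̃ p)
          ≈⟨ sum-remove {i = j} (λ p → A i p * c̃ p) ⟩
        A i j * c̃ j + sum (λ q → A i (punchIn j q) * c̃ (punchIn j q))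
          ≈⟨ +-cong (*-congˡ (reflexive (insertAt-lookup c j s)))
                    (sum-cong-≋ (λ q → *-congˡ (reflexive (insertAt-punchIn c j s q)))) ⟩
        A i j * s + sum (λ q → A i (punchIn j q) * c q)
          ≈⟨ +-congʳ (*-distribˡ-sum (A i j) (λ q → r q * c q)) ⟩
        sum (λ q → A i j * (r q * c q)) + sum (λ q → A i (punchIn j q) * c q)
          ≈⟨ ∑-distrib-+ (λ q → A i j * (r q * c q)) (λ q → A i (punchIn j q) * c q) ⟨
        sum (λ q → A i j * (r q * c q) + A i (punchIn j q) * c q)
          ≈⟨ sum-cong-≋ (λ q → solve 4 (λ a r c b → a :* (r :* c) :+ b :* c := (b :+ a :* r) :* c) refl (A i j) (r q) (c q) (A i (punchIn j q))) ⟩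
        sum (λ q → reduced i q * c q) ∎

      zeros : ∀ i → sum (λ q → reduced i q * c q) ≈ 0#
      zeros zero    = sum-0 λ q → trans (*-congʳ (reduced-zero q)) (zeroˡ _)
      zeros (suc i) = e i

    -- The matrix B puts column j first and performs the elimination on the others. On the rows of
    -- `take J` the product A B then has first row (A zero j, 0, ..., 0), so its determinant is the
    -- pivot times the reduced minor, and it is also a multiple of the minor of A.
    minor≉0 : (J : k ⊑ n) → ¬ minorAt (reduced ∘ suc) J ≈ 0# → ¬ minorAt A (take J) ≈ 0#
    minor≉0 J d≉0 A≈0 = d≉0 (x*y≈0⇒y≈0 A₀ⱼ≉0 (begin
      A zero j * minorAt (reduced ∘ suc) J
        ≈⟨ *-cong A⊙B₀ (det-cong λ p q → A⊙B⁺ (suc (elem J p)) q) ⟨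
      AB zero zero * det (minor zero AB)
        ≈⟨ trans (*-congʳ (sym (*-identityˡ _))) (sym (sum-single (laplaceTerm AB) zero vanish)) ⟩
      det AB
        ≈⟨ ⊙-det det-isAlternating (λ p → A (elem (take J) p)) B ⟩
      minorAt A (take J) * det B
        ≈⟨ trans (*-congʳ A≈0) (zeroˡ _) ⟩
      0# ∎))
      where
      B : Matrix (Fin (suc k)) (suc k)
      B p zero    = δ p j
      B p (suc q) = δ p (punchIn j q) + δ p j * r q

      AB : Matrix (Fin (suc k)) (suc k)
      AB p = (A ⊙ B) (elem (take J) p)

      A⊙B₀ : AB zero zero ≈ A zero j
      A⊙B₀ = sum-δ (A zero) j

      A⊙B⁺ : ∀ i q → (A ⊙ B) i (suc q) ≈ reduced i q
      A⊙B⁺ i q = begin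
        sum (λ p → A i p * (δ p (punchIn j q) + δ p j * r q))
          ≈⟨ sum-cong-≋ (λ p → trans (distribˡ (A i p) (δ p (punchIn j q)) (δ p j * r q))
               (+-congˡ (sym (*-assoc (A i p) (δ p j) (r q))))) ⟩
        sum (λ p → A i p * δ p (punchIn j q) + A i p * δ p j * r q)
          ≈⟨ ∑-distrib-+ (λ p → A i p * δ p (punchIn j q)) (λ p → A i p * δ p j * r q) ⟩
        sum (λ p → A i p * δ p (punchIn j q)) + sum (λ p → A i p * δ p j * r q)
          ≈⟨ +-cong (sum-δ (A i) (punchIn j q)) (trans (sym (*-distribʳ-sum (r q) (λ p → A i p * δ p j))) (*-congʳ (sum-δ (A i) j))) ⟩
        reduced i q ∎

      vanish : ∀ p → p ≢ zero → laplaceTerm AB p ≈ 0#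
      vanish zero    0≢0 = contradiction ≡.refl 0≢0
      vanish (suc p) _   = trans (*-congʳ (trans (*-congˡ (trans (A⊙B⁺ zero p) (reduced-zero p))) (zeroʳ _))) (zeroˡ _)

  -- Gaussian elimination, one row at a time: a row with a nonzero entry joins J and uses up a
  -- column, a zero row is skipped. A kernel vector appears if columns are left when the rows run
  -- out.
  kernel-or-minor : ∀ k n (A : Matrix (Fin n) k) →
                    HasKernel A ⊎ ∃ λ (J : k ⊑ n) → ¬ minorAt A J ≈ 0#
  kernel-or-minor zero    zero    A = inj₂ (done , 0≉1 ∘ sym)
  kernel-or-minor (suc k) zero    A = inj₁ ((λ _ → 1#) , (zero , 0≉1 ∘ sym) , λ ())
  kernel-or-minor k       (suc n) A with any? (λ j → ¬? (A zero j ≟ 0#))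
  kernel-or-minor (suc k) (suc n) A | yes (j , A₀ⱼ≉0)
    with kernel-or-minor k n (Pivot.reduced A j A₀ⱼ≉0 ∘ suc)
  ... | inj₁ ker       = inj₁ (Pivot.kernel A j A₀ⱼ≉0 ker)
  ... | inj₂ (J , d≉0) = inj₂ (take J , Pivot.minor≉0 A j A₀ⱼ≉0 J d≉0)
  kernel-or-minor k       (suc n) A | no A₀≈0 with kernel-or-minor k n (A ∘ suc)
  ... | inj₁ (c , c≉0 , e) = inj₁ (c , c≉0 , λ where
          zero    → sum-0 λ j → trans (*-congʳ (decidable-stable (A zero j ≟ 0#) (λ ¬e → A₀≈0 (j , ¬e)))) (zeroˡ _)
          (suc i) → e i)
  ... | inj₂ (J , d≉0) = inj₂ (skip J , d≉0)

  -- The augmented matrix (b | A) has more columns than rows, hence a kernel vector c. Its first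
  -- entry is nonzero because A has trivial kernel, and dividing by minus that entry solves the
  -- system.
  solvable : ∀ {k} (A : Matrix (Fin k) k) → ¬ det A ≈ 0# → ∀ b →
             ∃ λ x → ∀ i → sum (λ j → A i j * x j) ≈ b i
  solvable {k} A d≉0 b with kernel-or-minor (suc k) k (b ∷ᶜ A)
  ... | inj₂ (J , _) = contradiction (⊑⇒≤ J) 1+n≰n
  ... | inj₁ (c , (j , cj≉0) , e) with c zero ≟ 0#
  ... | yes c₀≈0 = contradiction (c≈0 j) cj≉0
    where
    c≈0 : ∀ j → c j ≈ 0#
    c≈0 zero    = c₀≈0
    c≈0 (suc j) = alternating-kernel det-isAlternating A d≉0 (tail c)
      (λ i → trans (sym (trans (+-congʳ (trans (*-congˡ c₀≈0) (zeroʳ _))) (+-identityˡ _))) (e i)) j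
  ... | no  c₀≉0 with y , cy≈1 ← inverse (c zero) c₀≉0 = (λ j → c (suc j) * - y) , λ i → begin
    sum (λ j → A i j * (c (suc j) * - y))
      ≈⟨ sum-cong-≋ (λ j → sym (*-assoc (A i j) (c (suc j)) (- y))) ⟩
    sum (λ j → A i j * c (suc j) * - y)
      ≈⟨ *-distribʳ-sum (- y) (λ j → A i j * c (suc j)) ⟨
    sum (λ j → A i j * c (suc j)) * - y
      ≈⟨ *-congʳ (inverseʳ-unique _ _ (e i)) ⟩
    - (b i * c zero) * - y
      ≈⟨ trans (sym (-‿distribˡ-* _ _)) (trans (-‿cong (sym (-‿distribʳ-* _ _))) (-‿involutive _)) ⟩
    b i * c zero * y
      ≈⟨ trans (*-assoc _ _ _) (trans (*-congˡ cy≈1) (*-identityʳ _)) ⟩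
    b i ∎
    where open RingProperties ring using (-‿involutive)

  -- C is A times the inverse B of its rows ρ. Solving for each unit vector makes B a right inverse;
  -- it is a left inverse since those rows have trivial kernel, which contains every column of B (A
  -- ∘ ρ) - 1.
  normalise : ∀ {I k} (A : Matrix I k) (ρ : Fin k → I) → ¬ det (A ∘ ρ) ≈ 0# →
    ∃ λ (C : Matrix I k) → (∀ i j → A i j ≈ (C ⊙ (A ∘ ρ)) i j) × (∀ p j → C (ρ p) j ≈ δ p j)
  normalise {I} {k} A ρ d≉0 = A ⊙ B , (λ i j → sym (begin
      ((A ⊙ B) ⊙ (A ∘ ρ)) i j  ≈⟨ ⊙-assoc A B (A ∘ ρ) i j ⟩
      (A ⊙ (B ⊙ (A ∘ ρ))) i j  ≈⟨ sum-cong-≋ (λ p → *-congˡ (left-inverse p j)) ⟩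
      sum (λ p → A i p * δ p j) ≈⟨ sum-δ (A i) j ⟩
      A i j                     ∎))
    , right-inverse
    where
    B : Matrix (Fin k) k
    B p j = proj₁ (solvable (A ∘ ρ) d≉0 (λ i → δ i j)) p

    right-inverse : ∀ p j → (A ⊙ B) (ρ p) j ≈ δ p j
    right-inverse p j = proj₂ (solvable (A ∘ ρ) d≉0 (λ i → δ i j)) p

    left-inverse : ∀ p j → (B ⊙ (A ∘ ρ)) p j ≈ δ p j
    left-inverse p j = x∙y⁻¹≈ε⇒x≈y _ _ (alternating-kernel det-isAlternating (A ∘ ρ) d≉0
      (λ p → BA p j + - δ p j) (λ i → begin
        sum (λ p → A (ρ i) p * (BA p j + - δ p j))
          ≈⟨ sum-cong-≋ (λ p → trans (distribˡ (A (ρ i) p) (BA p j) (- δ p j))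
               (+-congˡ (trans (sym (-‿distribʳ-* (A (ρ i) p) (δ p j))) (-‿distribˡ-* (A (ρ i) p) (δ p j))))) ⟩
        sum (λ p → A (ρ i) p * BA p j + - A (ρ i) p * δ p j)
          ≈⟨ ∑-distrib-+ (λ p → A (ρ i) p * BA p j) (λ p → - A (ρ i) p * δ p j) ⟩
        ((A ∘ ρ) ⊙ BA) i j + sum (λ p → - A (ρ i) p * δ p j)
          ≈⟨ +-cong (sym (⊙-assoc (A ∘ ρ) B (A ∘ ρ) i j)) (sum-δ (λ p → - A (ρ i) p) j) ⟩
        (((A ∘ ρ) ⊙ B) ⊙ (A ∘ ρ)) i j + - A (ρ i) j
          ≈⟨ +-congʳ (sum-cong-≋ {y = λ q → δ i q * A (ρ q) j} (λ q → *-congʳ (right-inverse i q))) ⟩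
        sum (λ q → δ i q * A (ρ q) j) + - A (ρ i) j
          ≈⟨ +-congʳ (sum-δˡ (λ q → A (ρ q) j) i) ⟩
        A (ρ i) j + - A (ρ i) j
          ≈⟨ -‿inverseʳ _ ⟩
        0# ∎) p)
      where BA = B ⊙ (A ∘ ρ)

-- Polynomials in one variable as coefficient lists.

module CoefficientLists {c ℓ} (K : CommutativeRing c ℓ) where

  open CommutativeRing K hiding (zero)
  open SemiringSolver commutativeSemiring using (solve; _:=_; _:+_; _:*_; con)
  open SetoidReasoning setoid

  eval : List Carrier → Carrier → Carrier
  eval []      s = 0#
  eval (c ∷ p) s = c + s * eval p s

  infixl 6 _⊞_
  infixl 7 _⊠_

  _⊞_ _⊠_ : List Carrier → List Carrier → List Carrier
  []      ⊞ q       = q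
  (c ∷ p) ⊞ []      = c ∷ p
  (c ∷ p) ⊞ (d ∷ q) = c + d ∷ p ⊞ q
  []      ⊠ q = []
  (c ∷ p) ⊠ q = map (c *_) q ⊞ (0# ∷ p ⊠ q)

  eval-⊞ : ∀ p q s → eval (p ⊞ q) s ≈ eval p s + eval q s
  eval-⊞ []      q       s = sym (+-identityˡ _)
  eval-⊞ (c ∷ p) []      s = sym (+-identityʳ _)
  eval-⊞ (c ∷ p) (d ∷ q) s = trans (+-congˡ (*-congˡ (eval-⊞ p q s)))
    (solve 5 (λ c d s x y → c :+ d :+ s :* (x :+ y) := (c :+ s :* x) :+ (d :+ s :* y)) refl c d s (eval p s) (eval q s))

  eval-map : ∀ c p s → eval (map (c *_) p) s ≈ c * eval p s
  eval-map c []      s = sym (zeroʳ c)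
  eval-map c (d ∷ p) s = trans (+-congˡ (*-congˡ (eval-map c p s)))
    (solve 4 (λ c d s x → c :* d :+ s :* (c :* x) := c :* (d :+ s :* x)) refl c d s (eval p s))

  eval-⊠ : ∀ p q s → eval (p ⊠ q) s ≈ eval p s * eval q s
  eval-⊠ []      q s = sym (zeroˡ _)
  eval-⊠ (c ∷ p) q s = begin
    eval (map (c *_) q ⊞ (0# ∷ p ⊠ q)) s
      ≈⟨ eval-⊞ (map (c *_) q) _ s ⟩
    eval (map (c *_) q) s + (0# + s * eval (p ⊠ q) s)
      ≈⟨ +-cong (eval-map c q s) (trans (+-identityˡ _) (*-congˡ (eval-⊠ p q s))) ⟩
    c * eval q s + s * (eval p s * eval q s)
      ≈⟨ solve 4 (λ c s x y → c :* y :+ s :* (x :* y) := (c :+ s :* x) :* y) refl c s (eval p s) (eval q s) ⟩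
    (c + s * eval p s) * eval q s ∎

  eval-0 : ∀ {p} → All (_≈ 0#) p → ∀ s → eval p s ≈ 0#
  eval-0 []       s = refl
  eval-0 (e ∷ es) s = trans (+-cong e (trans (*-congˡ (eval-0 es s)) (zeroʳ s))) (+-identityˡ 0#)

  coeff₀ : List Carrier → Carrier
  coeff₀ []      = 0#
  coeff₀ (c ∷ p) = c

  quotient : List Carrier → List Carrier
  quotient []      = []
  quotient (c ∷ p) = p

  coeff₁ : List Carrier → Carrier
  coeff₁ = coeff₀ ∘ quotient

  eval-split : ∀ p s → eval p s ≈ coeff₀ p + s * eval (quotient p) s
  eval-split []      s = sym (trans (+-identityˡ _) (zeroʳ s))
  eval-split (c ∷ p) s = refl

  eval-at-0 : ∀ p → eval p 0# ≈ coeff₀ p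
  eval-at-0 p = trans (eval-split p 0#) (trans (+-congˡ (zeroˡ _)) (+-identityʳ _))

  coeff₀-⊞ : ∀ p q → coeff₀ (p ⊞ q) ≈ coeff₀ p + coeff₀ q
  coeff₀-⊞ []      q       = sym (+-identityˡ _)
  coeff₀-⊞ (c ∷ p) []      = sym (+-identityʳ _)
  coeff₀-⊞ (c ∷ p) (d ∷ q) = refl

  quotient-⊞ : ∀ p q → quotient (p ⊞ q) ≡ quotient p ⊞ quotient q
  quotient-⊞ []            q       = ≡.refl
  quotient-⊞ (c ∷ [])      []      = ≡.refl
  quotient-⊞ (c ∷ (d ∷ p)) []      = ≡.refl
  quotient-⊞ (c ∷ p)       (d ∷ q) = ≡.refl

  coeff₁-⊞ : ∀ p q → coeff₁ (p ⊞ q) ≈ coeff₁ p + coeff₁ q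
  coeff₁-⊞ p q = trans (reflexive (≡.cong coeff₀ (quotient-⊞ p q))) (coeff₀-⊞ (quotient p) (quotient q))

  coeff₀-map : ∀ c p → coeff₀ (map (c *_) p) ≈ c * coeff₀ p
  coeff₀-map c []      = sym (zeroʳ c)
  coeff₀-map c (d ∷ p) = refl

  coeff₁-map : ∀ c p → coeff₁ (map (c *_) p) ≈ c * coeff₁ p
  coeff₁-map c []      = sym (zeroʳ c)
  coeff₁-map c (d ∷ p) = coeff₀-map c p

  coeff₀-⊠ : ∀ p q → coeff₀ (p ⊠ q) ≈ coeff₀ p * coeff₀ q
  coeff₀-⊠ []      q = sym (zeroˡ _)
  coeff₀-⊠ (c ∷ p) q = trans (coeff₀-⊞ (map (c *_) q) _) (trans (+-identityʳ _) (coeff₀-map c q))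

  coeff₁-⊠ : ∀ p q → coeff₁ (p ⊠ q) ≈ coeff₁ p * coeff₀ q + coeff₀ p * coeff₁ q
  coeff₁-⊠ []      q = sym (trans (+-cong (zeroˡ _) (zeroˡ _)) (+-identityˡ _))
  coeff₁-⊠ (c ∷ p) q = trans (coeff₁-⊞ (map (c *_) q) _)
    (trans (+-comm _ _) (+-cong (coeff₀-⊠ p q) (coeff₁-map c q)))

  -- The coefficients of w p(2s) − p(s), where p is the given list.
  dilate : Carrier → List Carrier → List Carrier
  dilate w []      = []
  dilate w (c ∷ p) = (w + - 1#) * c ∷ dilate ((1# + 1#) * w) p

  length-dilate : ∀ w p → length (dilate w p) ≡ length p
  length-dilate w []      = ≡.refl
  length-dilate w (c ∷ p) = ≡.cong suc (length-dilate _ p)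

  eval-dilate : ∀ w p s → eval (dilate w p) s + eval p s ≈ w * eval p ((1# + 1#) * s)
  eval-dilate w []      s = trans (+-identityˡ 0#) (sym (zeroʳ w))
  eval-dilate w (c ∷ p) s = begin
    ((w + - 1#) * c + s * eval (dilate (2# * w) p) s) + (c + s * eval p s)
      ≈⟨ solve 6 (λ w n c s x y → ((w :+ n) :* c :+ s :* x) :+ (c :+ s :* y) := w :* c :+ (n :+ con 1) :* c :+ s :* (x :+ y)) refl w (- 1#) c s (eval (dilate (2# * w) p) s) (eval p s) ⟩
    w * c + (- 1# + 1#) * c + s * (eval (dilate (2# * w) p) s + eval p s)
      ≈⟨ +-cong (trans (+-congˡ (trans (*-congʳ (-‿inverseˡ 1#)) (zeroˡ c))) (+-identityʳ _)) (*-congˡ (eval-dilate (2# * w) p s)) ⟩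
    w * c + s * (2# * w * eval p (2# * s))
      ≈⟨ solve 5 (λ t w c s x → w :* c :+ s :* (t :* w :* x) := w :* (c :+ t :* s :* x)) refl 2# w c s (eval p (2# * s)) ⟩
    w * (c + 2# * s * eval p (2# * s)) ∎
    where 2# = 1# + 1#

-- The form in which infinitude of the field is used: s ↦ 2s never leaves the nonzero elements, and
-- the factors 2^i - 1 with i ≥ 1 can be cancelled.
record TwoNotTorsion {c ℓ} (K : CommutativeRing c ℓ) : Set ℓ where
  open CommutativeRing K
  open Exp semiring using (_^_)
  field
    2≉0   : ¬ 1# + 1# ≈ 0#
    2^n≉1 : ∀ n → ¬ (1# + 1#) ^ suc n ≈ 1#

module FieldPolynomials {c ℓ} (F : DecidableField c ℓ)
  (twoNotTorsion : TwoNotTorsion (DecidableField.commutativeRing F)) where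

  open DecidableField F hiding (zero)
  open TwoNotTorsion twoNotTorsion
  open LinearAlgebra F using (x*y≈0⇒y≈0; sum; _^_; sum-cong-≋; *-distribˡ-sum)
  open CoefficientLists commutativeRing public
  open GroupProperties +-group using (x∙y⁻¹≈ε⇒x≈y; identityˡ-unique)
  open SemiringSolver commutativeSemiring using (solve; _:=_; _:+_; _:*_)
  open SetoidReasoning setoid

  -- Each coefficient has been multiplied by some 2^i - 1 with i ≥ 1, which is nonzero.
  dilate-zero : ∀ n p → All (_≈ 0#) (dilate ((1# + 1#) ^ suc n) p) → All (_≈ 0#) p
  dilate-zero n []      []       = []
  dilate-zero n (c ∷ p) (e ∷ es) =
    x*y≈0⇒y≈0 (2^n≉1 n ∘ x∙y⁻¹≈ε⇒x≈y _ _) e ∷ dilate-zero (suc n) p es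

  -- Subtracting p(s) from p(2s) removes the constant term, leaving s times a
  -- shorter polynomial.
  vanishing : ∀ n p → length p ≤ n → (∀ s → ¬ s ≈ 0# → eval p s ≈ 0#) → All (_≈ 0#) p
  vanishing n       []      _         _   = []
  vanishing (suc n) (c ∷ p) (s≤s len) p≈0 = c≈0 ∷ zeros
    where
    2# = 1# + 1#
    -- The weight starts at 2^1 because p is here the tail of the list, whose head is the
    -- coefficient of degree 1.
    quot : List Carrier
    quot = dilate (2# ^ 1) p

    quot≈0 : ∀ s → ¬ s ≈ 0# → eval quot s ≈ 0#
    quot≈0 s s≉0 = x*y≈0⇒y≈0 s≉0 (identityˡ-unique _ (c + s * eval p s) (begin
      s * eval quot s + (c + s * eval p s)
        ≈⟨ solve 4 (λ c s x y → s :* x :+ (c :+ s :* y) := c :+ s :* (x :+ y)) refl c s (eval quot s) (eval p s) ⟩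
      c + s * (eval quot s + eval p s)
        ≈⟨ +-congˡ (*-congˡ (eval-dilate (2# ^ 1) p s)) ⟩
      c + s * (2# ^ 1 * eval p (2# * s))
        ≈⟨ +-congˡ (trans (sym (*-assoc _ _ _)) (*-congʳ (trans (*-comm _ _) (*-congʳ (*-identityʳ 2#))))) ⟩
      c + 2# * s * eval p (2# * s)
        ≈⟨ p≈0 (2# * s) (λ 2s≈0 → s≉0 (x*y≈0⇒y≈0 2≉0 2s≈0)) ⟩
      0#
        ≈⟨ p≈0 s s≉0 ⟨
      c + s * eval p s ∎))

    zeros : All (_≈ 0#) p
    zeros = dilate-zero 0 p (vanishing n quot (≤-trans (≤-reflexive (length-dilate _ p)) len) quot≈0)

    c≈0 : c ≈ 0#
    c≈0 = begin
      c                ≈⟨ +-identityʳ c ⟨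
      c + 0#           ≈⟨ +-congˡ (trans (*-identityˡ _) (eval-0 zeros 1#)) ⟨
      c + 1# * eval p 1# ≈⟨ p≈0 1# (0≉1 ∘ sym) ⟩
      0#               ∎

  IsPolynomial : (Carrier → Carrier) → Set _
  IsPolynomial φ = ∃ λ p → ∀ s → φ s ≈ eval p s

  -- Restores the value at 0 after a factor s has been cancelled.
  vanishing-everywhere : ∀ {φ} → IsPolynomial φ → (∀ s → ¬ s ≈ 0# → φ s ≈ 0#) → ∀ s → φ s ≈ 0#
  vanishing-everywhere (p , e) φ≈0 s = trans (e s)
    (eval-0 (vanishing (length p) p ≤-refl λ t t≉0 → trans (sym (e t)) (φ≈0 t t≉0)) s)

  coeff₀-vanishing : ∀ p → (∀ s → ¬ s ≈ 0# → eval p s ≈ 0#) → coeff₀ p ≈ 0#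
  coeff₀-vanishing p p≈0 with p | vanishing (length p) p ≤-refl p≈0
  ... | []    | []    = refl
  ... | _ ∷ _ | e ∷ _ = e

  coeff₁-vanishing : ∀ p → (∀ s → ¬ s ≈ 0# → eval p s ≈ 0#) → coeff₁ p ≈ 0#
  coeff₁-vanishing p p≈0 with p | vanishing (length p) p ≤-refl p≈0
  ... | []        | []        = refl
  ... | _ ∷ []    | _ ∷ []    = refl
  ... | _ ∷ _ ∷ _ | _ ∷ e ∷ _ = e

  sum-isPolynomial : ∀ {m} (F : Fin m → List Carrier) → IsPolynomial λ s → sum λ r → eval (F r) s
  sum-isPolynomial {zero}  F = [] , λ _ → refl
  sum-isPolynomial {suc m} F with p , e ← sum-isPolynomial (F ∘ suc) =
    F zero ⊞ p , λ s → trans (+-congˡ (e s)) (sym (eval-⊞ (F zero) p s))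

  combination-isPolynomial : ∀ {m} (Q F : Fin m → List Carrier) →
    IsPolynomial λ s → sum λ r → eval (Q r) s * eval (F r) s
  combination-isPolynomial Q F with p , e ← sum-isPolynomial (λ r → Q r ⊠ F r) =
    p , λ s → trans (sum-cong-≋ (λ r → sym (eval-⊠ (Q r) (F r) s))) (e s)

  maximum : ∀ {m} → (Fin m → ℕ) → ℕ
  maximum {zero}  f = 0
  maximum {suc m} f = f zero ℕ.⊔ maximum (f ∘ suc)

  ≤-maximum : ∀ {m} (f : Fin m → ℕ) r → f r ≤ maximum f
  ≤-maximum f zero    = m≤m⊔n _ _
  ≤-maximum f (suc r) = ≤-trans (≤-maximum (f ∘ suc) r) (m≤n⊔m (f zero) _)

  length-quotient : ∀ {n} p → length p ≤ suc n → length (quotient p) ≤ n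
  length-quotient []      _       = z≤n
  length-quotient (c ∷ p) (s≤s l) = l

  -- Nakayama's lemma along a curve: the constant terms of the F r lie in the
  -- kernel of Q(0), so every F r is divisible by s.
  nakayama : ∀ {V : Set} {m} (Q : V → Fin m → List Carrier) →
    (∀ c → (∀ v → sum (λ r → eval (Q v r) 0# * c r) ≈ 0#) → ∀ r → c r ≈ 0#) →
    ∀ (F : Fin m → List Carrier) → (∀ v s → sum (λ r → eval (Q v r) s * eval (F r) s) ≈ 0#) →
    ∀ r s → eval (F r) s ≈ 0#
  nakayama {V} {m} Q inj F QF≈0 = bounded _ F (≤-maximum (length ∘ F)) QF≈0
    where
    -- The bound on the lengths makes the repeated division by s terminate: an empty list is the
    -- zero polynomial.
    bounded : ∀ n (F : Fin m → List Carrier) → (∀ r → length (F r) ≤ n) →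
      (∀ v s → sum (λ r → eval (Q v r) s * eval (F r) s) ≈ 0#) →
      ∀ r s → eval (F r) s ≈ 0#
    bounded zero F len _ r s with F r | len r
    ... | [] | _ = refl
    bounded (suc n) F len QF≈0 r s = trans (split r s)
        (trans (*-congˡ (bounded n (quotient ∘ F) (λ r → length-quotient (F r) (len r)) quotients r s)) (zeroʳ s))
      where
      constants : ∀ r → coeff₀ (F r) ≈ 0#
      constants = inj (coeff₀ ∘ F) λ v →
        trans (sum-cong-≋ (λ r → *-congˡ {x = eval (Q v r) 0#} (sym (eval-at-0 (F r))))) (QF≈0 v 0#)

      split : ∀ r s → eval (F r) s ≈ s * eval (quotient (F r)) s
      split r s = trans (eval-split (F r) s) (trans (+-congʳ (constants r)) (+-identityˡ _))

      quotients : ∀ v s → sum (λ r → eval (Q v r) s * eval (quotient (F r)) s) ≈ 0#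
      quotients v = vanishing-everywhere (combination-isPolynomial (Q v) (quotient ∘ F)) λ s s≉0 →
        x*y≈0⇒y≈0 s≉0 (begin
          s * sum (λ r → eval (Q v r) s * eval (quotient (F r)) s)
            ≈⟨ *-distribˡ-sum s (λ r → eval (Q v r) s * eval (quotient (F r)) s) ⟩
          sum (λ r → s * (eval (Q v r) s * eval (quotient (F r)) s))
            ≈⟨ sum-cong-≋ (λ r → trans (solve 3 (λ s q f → s :* (q :* f) := q :* (s :* f)) refl s (eval (Q v r) s) (eval (quotient (F r)) s))
                 (*-congˡ {x = eval (Q v r) s} (sym (split r s)))) ⟩
          sum (λ r → eval (Q v r) s * eval (F r) s)
            ≈⟨ QF≈0 v s ⟩
          0# ∎)

-- Squares and sums of nonnegative terms in an ordered field.

module OrderedField (ℝ : CompleteOrderedField) where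

  open CompleteOrderedField ℝ hiding (zero)
  open IsStrictTotalOrder isStrictTotalOrder public
    using (compare; <-respˡ-≈; <-respʳ-≈; irrefl) renaming (trans to <-trans; _≟_ to _≟ᴿ_)
  open RingProperties ring using (-‿distribˡ-*; -‿distribʳ-*; -‿involutive)
  open SetoidReasoning setoid

  +-pos : ∀ {x y} → 0# < x → 0# < y → 0# < x + y
  +-pos {x} {y} 0<x 0<y = <-trans 0<y (<-respˡ-≈ (+-identityˡ y) (+-monoˡ-< y 0<x))

  -‿pos : ∀ {x} → x < 0# → 0# < - x
  -‿pos {x} x<0 = <-respˡ-≈ (-‿inverseʳ x) (<-respʳ-≈ (+-identityˡ (- x)) (+-monoˡ-< (- x) x<0))

  -x*-x≈x*x : ∀ x → - x * - x ≈ x * x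
  -x*-x≈x*x x = trans (sym (-‿distribˡ-* x (- x))) (trans (-‿cong (sym (-‿distribʳ-* x x))) (-‿involutive _))

  x²>0 : ∀ {x} → ¬ x ≈ 0# → 0# < x * x
  x²>0 {x} x≉0 with compare 0# x
  ... | tri< 0<x _ _ = *-pos 0<x 0<x
  ... | tri≈ _ 0≈x _ = contradiction (sym 0≈x) x≉0
  ... | tri> _ _ x<0 = <-respʳ-≈ (-x*-x≈x*x x) (*-pos (-‿pos x<0) (-‿pos x<0))

  0<1 : 0# < 1#
  0<1 = <-respʳ-≈ (*-identityˡ 1#) (x²>0 (0≉1 ∘ sym))

  NonNegative : Carrier → Set
  NonNegative x = 0# < x ⊎ x ≈ 0#

  square-nonNegative : ∀ x → NonNegative (x * x)
  square-nonNegative x with x ≟ᴿ 0#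
  ... | yes x≈0 = inj₂ (trans (*-congˡ x≈0) (zeroʳ x))
  ... | no  x≉0 = inj₁ (x²>0 x≉0)

  square-zero : ∀ {x} → x * x ≈ 0# → x ≈ 0#
  square-zero {x} e with x ≟ᴿ 0#
  ... | yes x≈0 = x≈0
  ... | no  x≉0 = contradiction (x²>0 x≉0) (irrefl (sym e))

  +-nonNegative : ∀ {x y} → NonNegative x → NonNegative y → NonNegative (x + y)
  +-nonNegative (inj₁ p) (inj₁ q) = inj₁ (+-pos p q)
  +-nonNegative (inj₁ p) (inj₂ q) = inj₁ (<-respʳ-≈ (sym (trans (+-congˡ q) (+-identityʳ _))) p)
  +-nonNegative (inj₂ p) (inj₁ q) = inj₁ (<-respʳ-≈ (sym (trans (+-congʳ p) (+-identityˡ _))) q)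
  +-nonNegative (inj₂ p) (inj₂ q) = inj₂ (trans (+-cong p q) (+-identityˡ 0#))

  +-zero : ∀ {x y} → NonNegative x → NonNegative y → x + y ≈ 0# → x ≈ 0# × y ≈ 0#
  +-zero (inj₂ p) _        e = p , trans (sym (trans (+-congʳ p) (+-identityˡ _))) e
  +-zero (inj₁ p) (inj₁ q) e = contradiction (+-pos p q) (irrefl (sym e))
  +-zero (inj₁ p) (inj₂ q) e = trans (sym (trans (+-congˡ q) (+-identityʳ _))) e , q

  ∑ : ∀ {A : Set} → (A → Carrier) → List A → Carrier
  ∑ f = foldr (λ a s → f a + s) 0#

  ∑-cong : ∀ {A : Set} {f g : A → Carrier} → (∀ a → f a ≈ g a) → ∀ xs → ∑ f xs ≈ ∑ g xs
  ∑-cong e []       = refl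
  ∑-cong e (x ∷ xs) = +-cong (e x) (∑-cong e xs)

  ∑-distrib-+ : ∀ {A : Set} (f g : A → Carrier) xs → ∑ (λ a → f a + g a) xs ≈ ∑ f xs + ∑ g xs
  ∑-distrib-+ f g []       = sym (+-identityˡ 0#)
  ∑-distrib-+ f g (x ∷ xs) = trans (+-congˡ (∑-distrib-+ f g xs))
    (solve 4 (λ a b c d → a :+ b :+ (c :+ d) := (a :+ c) :+ (b :+ d)) refl (f x) (g x) (∑ f xs) (∑ g xs))
    where open SemiringSolver commutativeSemiring using (solve; _:=_; _:+_)

  *-distribʳ-∑ : ∀ {A : Set} c (f : A → Carrier) xs → ∑ (λ a → f a * c) xs ≈ ∑ f xs * c
  *-distribʳ-∑ c f []       = sym (zeroˡ c)
  *-distribʳ-∑ c f (x ∷ xs) = trans (+-congˡ (*-distribʳ-∑ c f xs)) (sym (distribʳ c _ _))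

  ∑-nonNegative : ∀ {A : Set} {f : A → Carrier} → (∀ a → NonNegative (f a)) → ∀ xs → NonNegative (∑ f xs)
  ∑-nonNegative f≥0 []       = inj₂ refl
  ∑-nonNegative f≥0 (x ∷ xs) = +-nonNegative (f≥0 x) (∑-nonNegative f≥0 xs)

  ∑-zero : ∀ {A : Set} {f : A → Carrier} → (∀ a → NonNegative (f a)) → ∀ {xs a} → a ∈ᴸ xs →
           ∑ f xs ≈ 0# → f a ≈ 0#
  ∑-zero f≥0 {x ∷ xs} (here ≡.refl) e = proj₁ (+-zero (f≥0 x) (∑-nonNegative f≥0 xs) e)
  ∑-zero f≥0 {x ∷ xs} (there a∈xs)  e = ∑-zero f≥0 a∈xs (proj₂ (+-zero (f≥0 x) (∑-nonNegative f≥0 xs) e))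

-- The complex numbers as a decidable field in which 2 has infinite order.

module ComplexField (ℝ : CompleteOrderedField) where

  open OrderedField ℝ public
  open Grassmannian ℝ
  private
    module R = CompleteOrderedField ℝ
    module C = CommutativeRing ℂ-commutativeRing
  open RingProperties R.ring using (-‿distribʳ-*; -0#≈0#)

  infix 4 _≟_
  -- Decidability comes from the trichotomy of the order on ℝ. Elimination and the case distinctions
  -- on vanishing coordinates rest on it.
  _≟_ : Decidable _≈_
  (a , b) ≟ (c , d) = (a ≟ᴿ c) ×-dec (b ≟ᴿ d)

  0≉1 : ¬ 0# ≈ 1#
  0≉1 (p , _) = R.0≉1 p

  ∥∥²-nonNegative : ∀ z → NonNegative ∥ z ∥²
  ∥∥²-nonNegative (a , b) = +-nonNegative (square-nonNegative a) (square-nonNegative b)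

  ∥∥²-zero : ∀ {z} → ∥ z ∥² R.≈ R.0# → z ≈ 0#
  ∥∥²-zero {a , b} e with p , q ← +-zero (square-nonNegative a) (square-nonNegative b) e =
    square-zero p , square-zero q

  zero-∥∥² : ∀ {z} → z ≈ 0# → ∥ z ∥² R.≈ R.0#
  zero-∥∥² {a , b} (p , q) = R.trans
    (R.+-cong (R.trans (R.*-congˡ p) (R.zeroʳ a)) (R.trans (R.*-congˡ q) (R.zeroʳ b))) (R.+-identityˡ _)

  inverse : ∀ z → ¬ z ≈ 0# → ∃ λ w → z * w ≈ 1#
  inverse z@(a , b) z≉0 = (a R.* n , R.- (b R.* n)) , re , im
    where
    n = ∥ z ∥² R.⁻¹
    open SetoidReasoning R.setoid
    re : a R.* (a R.* n) R.- b R.* R.- (b R.* n) R.≈ R.1#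
    re = begin
      a R.* (a R.* n) R.- b R.* R.- (b R.* n)
        ≈⟨ R.+-congˡ (R.trans (R.-‿cong (R.sym (-‿distribʳ-* b (b R.* n)))) (RingProperties.-‿involutive R.ring _)) ⟩
      a R.* (a R.* n) R.+ b R.* (b R.* n)
        ≈⟨ R.+-cong (R.*-assoc a a n) (R.*-assoc b b n) ⟨
      a R.* a R.* n R.+ b R.* b R.* n
        ≈⟨ R.distribʳ n _ _ ⟨
      ∥ z ∥² R.* n
        ≈⟨ R.⁻¹-inverseʳ ∥ z ∥² (z≉0 ∘ ∥∥²-zero) ⟩
      R.1# ∎
    im : a R.* R.- (b R.* n) R.+ b R.* (a R.* n) R.≈ R.0#
    im = begin
      a R.* R.- (b R.* n) R.+ b R.* (a R.* n)
        ≈⟨ R.+-cong (R.sym (-‿distribʳ-* a (b R.* n)))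
             (R.trans (R.sym (R.*-assoc b a n)) (R.trans (R.*-congʳ (R.*-comm b a)) (R.*-assoc a b n))) ⟩
      R.- (a R.* (b R.* n)) R.+ a R.* (b R.* n)
        ≈⟨ R.-‿inverseˡ _ ⟩
      R.0# ∎

  private
    2# = 1# + 1#

  module _ where
    open SetoidReasoning R.setoid

    2*-re : ∀ z → proj₁ (2# * z) R.≈ proj₁ z R.+ proj₁ z
    2*-re z@(a , b) = begin
      (R.1# R.+ R.1#) R.* a R.- (R.0# R.+ R.0#) R.* b
        ≈⟨ R.+-cong (R.trans (R.distribʳ a _ _) (R.+-cong (R.*-identityˡ a) (R.*-identityˡ a)))
             (R.trans (R.-‿cong (R.trans (R.*-congʳ (R.+-identityˡ _)) (R.zeroˡ b))) -0#≈0#) ⟩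
      a R.+ a R.+ R.0#
        ≈⟨ R.+-identityʳ _ ⟩
      a R.+ a ∎

  0<re-2^n : ∀ n → R.0# R.< proj₁ (2# ^ n)
  0<re-2^n zero    = 0<1
  0<re-2^n (suc n) = <-respʳ-≈ (R.sym (2*-re (2# ^ n))) (+-pos (0<re-2^n n) (0<re-2^n n))

  -- ℂ carries no order, so powers of 2 are told apart from 1 by their real parts, which double at
  -- each step.
  1<re-2^n : ∀ n → R.1# R.< proj₁ (2# ^ suc n)
  1<re-2^n zero    = <-respʳ-≈ (R.sym (2*-re 1#)) (<-respˡ-≈ (R.+-identityˡ R.1#) (R.+-monoˡ-< R.1# 0<1))
  1<re-2^n (suc n) = <-trans (1<re-2^n n) (<-respʳ-≈ (R.sym (2*-re (2# ^ suc n)))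
    (<-respˡ-≈ (R.+-identityˡ _) (R.+-monoˡ-< (proj₁ (2# ^ suc n)) (0<re-2^n (suc n)))))

  2^n≉1 : ∀ n → ¬ 2# ^ suc n ≈ 1#
  2^n≉1 n (e , _) = irrefl (R.sym e) (1<re-2^n n)

  2≉0 : ¬ 2# ≈ 0#
  2≉0 (e , _) = irrefl (R.sym e) (+-pos 0<1 0<1)

  ℂ-decidableField : DecidableField _ _
  ℂ-decidableField = record
    { commutativeRing = ℂ-commutativeRing
    ; _≟_     = _≟_
    ; 0≉1     = 0≉1
    ; inverse = inverse
    }

  ℂ-twoNotTorsion : TwoNotTorsion ℂ-commutativeRing
  ℂ-twoNotTorsion = record { 2≉0 = 2≉0 ; 2^n≉1 = 2^n≉1 }

-- Elements outside a subset.

coelem : ∀ {k n} (J : k ⊑ n) → Fin (codim J) → Fin n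
coelem (take J) q       = suc (coelem J q)
coelem (skip J) zero    = zero
coelem (skip J) (suc q) = suc (coelem J q)

position-coelem : ∀ {k n} (J : k ⊑ n) q → position J (coelem J q) ≡ inj₂ q
position-coelem (take J) q       = ≡.cong (⊎.map₁ suc) (position-coelem J q)
position-coelem (skip J) zero    = ≡.refl
position-coelem (skip J) (suc q) = ≡.cong (⊎.map₂ suc) (position-coelem J q)

at-position : ∀ {k n} (J : k ⊑ n) i → [ elem J , coelem J ]′ (position J i) ≡ i
at-position (take J) zero = ≡.refl
at-position (take J) (suc i) with position J i | at-position J i
... | inj₁ p | e = ≡.cong suc e
... | inj₂ q | e = ≡.cong suc e
at-position (skip J) zero = ≡.refl
at-position (skip J) (suc i) with position J i | at-position J i
... | inj₁ p | e = ≡.cong suc e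
... | inj₂ q | e = ≡.cong suc e

-- Polynomial expressions, their restrictions to lines and their differentials.

module PolynomialExpressions (ℝ : CompleteOrderedField) where

  open Grassmannian ℝ hiding (sum-δ)
  open ComplexField ℝ
  private module C = CommutativeRing ℂ-commutativeRing
  open LinearAlgebra ℂ-decidableField public
    using (x*y≈0⇒y≈0)
  open FieldPolynomials ℂ-decidableField ℂ-twoNotTorsion public
  open Sum C.semiring using (sum-cong-≋)
  open Exp C.semiring using (^-homo-*)
  open SemiringSolver C.commutativeSemiring using (solve; _:=_; _:+_; _:*_)
  open SetoidReasoning C.setoid

  private variable
    V U : Set

  ⟦⟧-cong : ∀ (F : Poly V) {x y} → (∀ v → x v ≈ y v) → ⟦ F ⟧ x ≈ ⟦ F ⟧ y
  ⟦⟧-cong (con c) e = C.refl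
  ⟦⟧-cong (var v) e = e v
  ⟦⟧-cong (p ⊕ q) e = C.+-cong (⟦⟧-cong p e) (⟦⟧-cong q e)
  ⟦⟧-cong (p ⊗ q) e = C.*-cong (⟦⟧-cong p e) (⟦⟧-cong q e)

  ⟦⟧-homogeneous : ∀ {d} {F : Poly V} → Homogeneous d F → ∀ c x →
                   ⟦ F ⟧ (λ v → c * x v) ≈ c ^ d * ⟦ F ⟧ x
  ⟦⟧-homogeneous (con a) c x = C.sym (C.*-identityˡ _)
  ⟦⟧-homogeneous (var v) c x = C.*-congʳ (C.sym (C.*-identityʳ c))
  ⟦⟧-homogeneous (p ⊕ q) c x = C.trans
    (C.+-cong (⟦⟧-homogeneous p c x) (⟦⟧-homogeneous q c x)) (C.sym (C.distribˡ _ _ _))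
  ⟦⟧-homogeneous (_⊗_ {d} {e} {P} {Q} p q) c x = begin
    ⟦ P ⟧ (λ v → c * x v) * ⟦ Q ⟧ (λ v → c * x v)
      ≈⟨ C.*-cong (⟦⟧-homogeneous p c x) (⟦⟧-homogeneous q c x) ⟩
    c ^ d * ⟦ P ⟧ x * (c ^ e * ⟦ Q ⟧ x)
      ≈⟨ solve 4 (λ a b y z → a :* y :* (b :* z) := a :* b :* (y :* z)) C.refl (c ^ d) (c ^ e) (⟦ P ⟧ x) (⟦ Q ⟧ x) ⟩
    c ^ d * c ^ e * (⟦ P ⟧ x * ⟦ Q ⟧ x)
      ≈⟨ C.*-congʳ (^-homo-* c d e) ⟨
    c ^ (d ℕ.+ e) * (⟦ P ⟧ x * ⟦ Q ⟧ x) ∎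

  bind : Poly V → (V → Poly U) → Poly U
  bind (con c) σ = con c
  bind (var v) σ = σ v
  bind (p ⊕ q) σ = bind p σ ⊕ bind q σ
  bind (p ⊗ q) σ = bind p σ ⊗ bind q σ

  ⟦bind⟧ : ∀ (F : Poly V) (σ : V → Poly U) x → ⟦ bind F σ ⟧ x ≡ ⟦ F ⟧ (λ v → ⟦ σ v ⟧ x)
  ⟦bind⟧ (con c) σ x = ≡.refl
  ⟦bind⟧ (var v) σ x = ≡.refl
  ⟦bind⟧ (p ⊕ q) σ x = ≡.cong₂ _+_ (⟦bind⟧ p σ x) (⟦bind⟧ q σ x)
  ⟦bind⟧ (p ⊗ q) σ x = ≡.cong₂ _*_ (⟦bind⟧ p σ x) (⟦bind⟧ q σ x)

  bind-homogeneous : ∀ {d} {F : Poly V} {σ : V → Poly U} → Homogeneous d F →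
                     (∀ v → Homogeneous 1 (σ v)) → Homogeneous d (bind F σ)
  bind-homogeneous (con c) h = con c
  bind-homogeneous (var v) h = h v
  bind-homogeneous (p ⊕ q) h = bind-homogeneous p h ⊕ bind-homogeneous q h
  bind-homogeneous (p ⊗ q) h = bind-homogeneous p h ⊗ bind-homogeneous q h

  polySum : ∀ {k} → (Fin k → Poly V) → Poly V
  polySum {k = zero}  f = con 0#
  polySum {k = suc k} f = f zero ⊕ polySum (f ∘ suc)

  ⟦polySum⟧ : ∀ {k} (f : Fin k → Poly V) x → ⟦ polySum f ⟧ x ≡ sum λ i → ⟦ f i ⟧ x
  ⟦polySum⟧ {k = zero}  f x = ≡.refl
  ⟦polySum⟧ {k = suc k} f x = ≡.cong (⟦ f zero ⟧ x +_) (⟦polySum⟧ (f ∘ suc) x)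

  polyDet : ∀ {k} → (Fin k → Fin k → Poly V) → Poly V
  polyDet {k = zero}  M = con 1#
  polyDet {k = suc k} M = polySum λ j →
    con ((- 1#) ^ toℕ j) ⊗ M zero j ⊗ polyDet (λ p q → M (suc p) (punchIn j q))

  ⟦polyDet⟧ : ∀ {k} (M : Fin k → Fin k → Poly V) x → ⟦ polyDet M ⟧ x ≈ det λ i j → ⟦ M i j ⟧ x
  ⟦polyDet⟧ {k = zero}  M x = C.refl
  ⟦polyDet⟧ {k = suc k} M x = C.trans
    (C.reflexive (⟦polySum⟧ (λ j → con ((- 1#) ^ toℕ j) ⊗ M zero j ⊗ polyDet (λ p q → M (suc p) (punchIn j q))) x))
    (sum-cong-≋ {x = λ j → (- 1#) ^ toℕ j * ⟦ M zero j ⟧ x * ⟦ polyDet (λ p q → M (suc p) (punchIn j q)) ⟧ x}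
                {y = λ j → (- 1#) ^ toℕ j * ⟦ M zero j ⟧ x * det (λ p q → ⟦ M (suc p) (punchIn j q) ⟧ x)}
      λ j → C.*-congˡ {x = (- 1#) ^ toℕ j * ⟦ M zero j ⟧ x} (⟦polyDet⟧ (λ p q → M (suc p) (punchIn j q)) x))

  -- The restriction to the line s ↦ s y, as a polynomial in s.
  onLine : Poly V → (V → ℂ) → List ℂ
  onLine (con c) y = c ∷ []
  onLine (var v) y = 0# ∷ y v ∷ []
  onLine (p ⊕ q) y = onLine p y ⊞ onLine q y
  onLine (p ⊗ q) y = onLine p y ⊠ onLine q y

  eval-onLine : ∀ (f : Poly V) y s → eval (onLine f y) s ≈ ⟦ f ⟧ (λ v → s * y v)
  eval-onLine (con c) y s = C.trans (C.+-congˡ (C.zeroʳ s)) (C.+-identityʳ c)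
  eval-onLine (var v) y s = C.trans (C.+-identityˡ _)
    (C.*-congˡ (C.trans (C.+-congˡ (C.zeroʳ s)) (C.+-identityʳ (y v))))
  eval-onLine (p ⊕ q) y s = C.trans (eval-⊞ (onLine p y) (onLine q y) s)
    (C.+-cong (eval-onLine p y s) (eval-onLine q y s))
  eval-onLine (p ⊗ q) y s = C.trans (eval-⊠ (onLine p y) (onLine q y) s)
    (C.*-cong (eval-onLine p y s) (eval-onLine q y s))

  origin : V → ℂ
  origin _ = 0#

  -- The derivative at the origin in direction y. It stands for the sum of y v times ∂_v f(0) over
  -- all variables v, without an enumeration of V.
  differential : Poly V → (V → ℂ) → ℂ
  differential (con c) y = 0#
  differential (var v) y = y v
  differential (p ⊕ q) y = differential p y + differential q y
  differential (p ⊗ q) y = differential p y * ⟦ q ⟧ origin + ⟦ p ⟧ origin * differential q y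

  coeff₀-onLine : ∀ (f : Poly V) y → coeff₀ (onLine f y) ≈ ⟦ f ⟧ origin
  coeff₀-onLine (con c) y = C.refl
  coeff₀-onLine (var v) y = C.refl
  coeff₀-onLine (p ⊕ q) y = C.trans (coeff₀-⊞ (onLine p y) (onLine q y))
    (C.+-cong (coeff₀-onLine p y) (coeff₀-onLine q y))
  coeff₀-onLine (p ⊗ q) y = C.trans (coeff₀-⊠ (onLine p y) (onLine q y))
    (C.*-cong (coeff₀-onLine p y) (coeff₀-onLine q y))

  coeff₁-onLine : ∀ (f : Poly V) y → coeff₁ (onLine f y) ≈ differential f y
  coeff₁-onLine (con c) y = C.refl
  coeff₁-onLine (var v) y = C.refl
  coeff₁-onLine (p ⊕ q) y = C.trans (coeff₁-⊞ (onLine p y) (onLine q y))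
    (C.+-cong (coeff₁-onLine p y) (coeff₁-onLine q y))
  coeff₁-onLine (p ⊗ q) y = C.trans (coeff₁-⊠ (onLine p y) (onLine q y))
    (C.+-cong (C.*-cong (coeff₁-onLine p y) (coeff₀-onLine q y))
              (C.*-cong (coeff₀-onLine p y) (coeff₁-onLine q y)))

  vanishing-at-origin : ∀ (f : Poly V) y → (∀ s → ¬ s ≈ 0# → ⟦ f ⟧ (λ v → s * y v) ≈ 0#) → ⟦ f ⟧ origin ≈ 0#
  vanishing-at-origin f y h = C.trans (C.sym (coeff₀-onLine f y))
    (coeff₀-vanishing (onLine f y) λ s s≉0 → C.trans (eval-onLine f y s) (h s s≉0))

  -- The differential is the coefficient of s in f(s y), and every coefficient is determined by the
  -- values at s ≠ 0.
  vanishing-differential : ∀ (f : Poly V) y → (∀ s → ¬ s ≈ 0# → ⟦ f ⟧ (λ v → s * y v) ≈ 0#) → differential f y ≈ 0#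
  vanishing-differential f y h = C.trans (C.sym (coeff₁-onLine f y))
    (coeff₁-vanishing (onLine f y) λ s s≉0 → C.trans (eval-onLine f y s) (h s s≉0))

  differential-cong : ∀ (f : Poly V) {y z} → (∀ v → y v ≈ z v) → differential f y ≈ differential f z
  differential-cong (con c) e = C.refl
  differential-cong (var v) e = e v
  differential-cong (p ⊕ q) e = C.+-cong (differential-cong p e) (differential-cong q e)
  differential-cong (p ⊗ q) e = C.+-cong (C.*-congʳ (differential-cong p e)) (C.*-congˡ (differential-cong q e))

  differential-+ : ∀ (f : Poly V) y z → differential f (λ v → y v + z v) ≈ differential f y + differential f z
  differential-+ (con c) y z = C.sym (C.+-identityˡ 0#)
  differential-+ (var v) y z = C.refl
  differential-+ (p ⊕ q) y z = C.trans (C.+-cong (differential-+ p y z) (differential-+ q y z))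
    (solve 4 (λ a b c d → a :+ b :+ (c :+ d) := a :+ c :+ (b :+ d)) C.refl
      (differential p y) (differential p z) (differential q y) (differential q z))
  differential-+ (p ⊗ q) y z = C.trans (C.+-cong (C.*-congʳ (differential-+ p y z)) (C.*-congˡ (differential-+ q y z)))
    (solve 6 (λ a b c d x w → (a :+ b) :* x :+ w :* (c :+ d) := a :* x :+ w :* c :+ (b :* x :+ w :* d)) C.refl
      (differential p y) (differential p z) (differential q y) (differential q z) (⟦ q ⟧ origin) (⟦ p ⟧ origin))

  differential-* : ∀ (f : Poly V) y c → differential f (λ v → y v * c) ≈ differential f y * c
  differential-* (con a) y c = C.sym (C.zeroˡ c)
  differential-* (var v) y c = C.refl
  differential-* (p ⊕ q) y c = C.trans (C.+-cong (differential-* p y c) (differential-* q y c)) (C.sym (C.distribʳ c _ _))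
  differential-* (p ⊗ q) y c = C.trans (C.+-cong (C.*-congʳ (differential-* p y c)) (C.*-congˡ (differential-* q y c)))
    (solve 5 (λ a b c x w → a :* c :* x :+ w :* (b :* c) := (a :* x :+ w :* b) :* c) C.refl
      (differential p y) (differential q y) c (⟦ q ⟧ origin) (⟦ p ⟧ origin))

  differential-0 : ∀ (f : Poly V) {y} → (∀ v → y v ≈ 0#) → differential f y ≈ 0#
  differential-0 (con c) e = C.refl
  differential-0 (var v) e = e v
  differential-0 (p ⊕ q) e = C.trans (C.+-cong (differential-0 p e) (differential-0 q e)) (C.+-identityˡ 0#)
  differential-0 (p ⊗ q) e = C.trans (C.+-cong
    (C.trans (C.*-congʳ (differential-0 p e)) (C.zeroˡ _))
    (C.trans (C.*-congˡ (differential-0 q e)) (C.zeroʳ _))) (C.+-identityˡ 0#)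

  differential-sum : ∀ (f : Poly V) {m} (y : Fin m → V → ℂ) (c : Vector ℂ m) →
    differential f (λ v → sum λ r → y r v * c r) ≈ sum λ r → differential f (y r) * c r
  differential-sum f {zero}  y c = differential-0 f λ _ → C.refl
  differential-sum f {suc m} y c = C.trans
    (differential-+ f (λ v → y zero v * c zero) (λ v → sum λ r → y (suc r) v * c (suc r)))
    (C.+-cong (differential-* f (y zero) (c zero)) (differential-sum f (y ∘ suc) (c ∘ suc)))

  differential-polySum : ∀ {m} (f : Fin m → Poly V) y → differential (polySum f) y ≡ sum λ r → differential (f r) y
  differential-polySum {m = zero}  f y = ≡.refl
  differential-polySum {m = suc m} f y = ≡.cong (differential (f zero) y +_) (differential-polySum (f ∘ suc) y)

  basis : DecidableEquality V → V → V → ℂ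
  basis _≟ⱽ_ v w = if does (v ≟ⱽ w) then 1# else 0#

  differential-basis : (_≟ⱽ_ : DecidableEquality V) → ∀ v (f : Poly V) →
    differential f (basis _≟ⱽ_ v) ≡ ⟦ ∂ _≟ⱽ_ v f ⟧ origin
  differential-basis _≟ⱽ_ v (con c) = ≡.refl
  differential-basis _≟ⱽ_ v (var w) = ≡.refl
  differential-basis _≟ⱽ_ v (p ⊕ q) = ≡.cong₂ _+_ (differential-basis _≟ⱽ_ v p) (differential-basis _≟ⱽ_ v q)
  differential-basis _≟ⱽ_ v (p ⊗ q) = ≡.cong₂ (λ a b → a * ⟦ q ⟧ origin + ⟦ p ⟧ origin * b)
    (differential-basis _≟ⱽ_ v p) (differential-basis _≟ⱽ_ v q)

  -- `differential` is computed from the expression, whereas polynomial identities are given by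
  -- values. The difference f - g vanishes along the line in direction y, hence so does its linear
  -- coefficient.
  differential-≗ : ∀ (f g : Poly V) → (∀ x → ⟦ f ⟧ x ≈ ⟦ g ⟧ x) → ∀ y → differential f y ≈ differential g y
  differential-≗ f g f≗g y = x∙y⁻¹≈ε⇒x≈y _ _ (begin
    differential f y + - differential g y
      ≈⟨ C.+-congˡ (-1*x≈-x _) ⟨
    differential f y + - 1# * differential g y
      ≈⟨ C.+-congˡ (C.trans (C.+-congʳ (C.zeroˡ _)) (C.+-identityˡ _)) ⟨
    differential f y + (0# * ⟦ g ⟧ origin + - 1# * differential g y)
      ≈⟨ vanishing-differential (f ⊕ con (- 1#) ⊗ g) y (λ s _ → C.trans (C.+-congˡ (-1*x≈-x _)) (x≈y⇒x∙y⁻¹≈ε (f≗g _))) ⟩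
    0# ∎)
    where
    open GroupProperties C.+-group using (x∙y⁻¹≈ε⇒x≈y; x≈y⇒x∙y⁻¹≈ε)
    open RingProperties C.ring using (-1*x≈-x)

-- Plücker coordinates on torus orbits and their closures.

module OrbitClosures (ℝ : CompleteOrderedField) where

  open Grassmannian ℝ hiding (sum-δ; δ; det; Matrix) renaming (_·_ to _·ᴳ_)
  private module G = Grassmannian ℝ
  open ComplexField ℝ
  open PolynomialExpressions ℝ
  private module C = CommutativeRing ℂ-commutativeRing
  open LinearAlgebra ℂ-decidableField
    using (det; δ; sum-δ; _⊙_; product; det-cong; ⊙-det; det-isAlternating; det-scale-rows; minorAt)
  open Sum C.semiring using (sum-cong-≋; *-distribˡ-sum)
  open SemiringSolver C.commutativeSemiring using (solve; _:=_; _:*_)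
  open SetoidReasoning C.setoid

  private variable
    k n : ℕ

  -- Both sides run the same Laplace recursion but are separate functions; the identification gives
  -- access to the lemmas on alternating forms.
  det≈ : (A : G.Matrix k k) → G.det A ≈ det A
  det≈ {zero}  A = C.refl
  det≈ {suc k} A = sum-cong-≋
    {x = λ j → (- 1#) ^ toℕ j * A zero j * G.det (λ p q → A (suc p) (punchIn j q))}
    {y = λ j → (- 1#) ^ toℕ j * A zero j * det (λ p q → A (suc p) (punchIn j q))}
    λ j → C.*-congˡ {x = (- 1#) ^ toℕ j * A zero j} (det≈ (λ p q → A (suc p) (punchIn j q)))

  minors : G.Matrix n k → k ⊑ n → ℂ
  minors A K = G.det λ p → A (elem K p)

  minors-cong : {A B : G.Matrix n k} → (∀ i j → A i j ≈ B i j) → ∀ K → minors A K ≈ minors B K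
  minors-cong {A = A} {B} e K = begin
    minors A K    ≈⟨ det≈ (λ p → A (elem K p)) ⟩
    minorAt A K   ≈⟨ det-cong (λ p j → e (elem K p) j) ⟩
    minorAt B K   ≈⟨ det≈ (λ p → B (elem K p)) ⟨
    minors B K    ∎

  -- The character by which the torus scales the Plücker coordinate of K.
  weight : Vector ℂ n → k ⊑ n → ℂ
  weight t K = product (t ∘ elem K)

  minors-scale : ∀ t (A : G.Matrix n k) K → minors (λ i j → t i * A i j) K ≈ weight t K * minors A K
  minors-scale t A K = begin
    minors (λ i j → t i * A i j) K   ≈⟨ det≈ (λ p j → t (elem K p) * A (elem K p) j) ⟩
    minorAt (λ i j → t i * A i j) K  ≈⟨ det-scale-rows (t ∘ elem K) (A ∘ elem K) ⟩
    weight t K * minorAt A K         ≈⟨ C.*-congˡ {x = weight t K} (det≈ (A ∘ elem K)) ⟨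
    weight t K * minors A K          ∎

  minors-⊙ : ∀ (A : G.Matrix n k) B K → minors (A ⊙ B) K ≈ minors A K * det B
  minors-⊙ A B K = begin
    minors (A ⊙ B) K       ≈⟨ det≈ (λ p → (A ⊙ B) (elem K p)) ⟩
    det ((A ∘ elem K) ⊙ B) ≈⟨ ⊙-det det-isAlternating (A ∘ elem K) B ⟩
    minorAt A K * det B    ≈⟨ C.*-congʳ {x = det B} (det≈ (A ∘ elem K)) ⟨
    minors A K * det B     ∎

  weight-* : ∀ (t u : Vector ℂ n) (K : k ⊑ n) → weight (λ i → t i * u i) K ≈ weight t K * weight u K
  weight-* t u K = CMSum.∑-distrib-+ C.*-commutativeMonoid (t ∘ elem K) (u ∘ elem K)

  *-torus : Torus n → Torus n → Torus n
  *-torus t u = record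
    { coord   = λ i → coord t i * coord u i
    ; nonzero = λ i e → nonzero u i (x*y≈0⇒y≈0 (nonzero t i) e)
    }

  scale-· : ∀ (t : Vector ℂ n) (A : G.Matrix n k) c i →
    t i * (A ·ᴳ c) i ≈ ((λ i j → t i * A i j) ·ᴳ c) i
  scale-· t A c i = C.trans (*-distribˡ-sum (t i) (λ j → A i j * c j))
    (sum-cong-≋ (λ j → C.sym (C.*-assoc (t i) (A i j) (c j))))

  translate : Torus n → Gr k n → Gr k n
  translate t X = record
    { matrix      = λ i j → coord t i * matrix X i j
    ; independent = λ c e → independent X c λ i → x*y≈0⇒y≈0 (nonzero t i)
        (C.trans (scale-· (coord t) (matrix X) c i) (e i))
    }

  translate∈Orbit : ∀ (t : Torus n) (X : Gr k n) → translate t X ∈ Orbit X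
  translate∈Orbit t X = t
    , (λ { v (c , e) → c , λ i → C.trans (C.*-congˡ {x = coord t i} (e i)) (scale-· (coord t) (matrix X) c i) })
    , (λ { w (c , e) → (matrix X ·ᴳ c) , (c , λ i → C.refl) , λ i → C.trans (e i) (C.sym (scale-· (coord t) (matrix X) c i)) })

  Plücker-translate : ∀ (t : Torus n) (X : Gr k n) K →
    Plücker (translate t X) K ≈ weight (coord t) K * Plücker X K
  Plücker-translate t X K = minors-scale (coord t) (matrix X) K

  -- The columns of W lie in tX; their coordinates in the basis of tX form a square matrix S, and
  -- `det S` is the common factor c.
  Plücker-orbit : ∀ {X W : Gr k n} → W ∈ Orbit X → ∃ λ c → ∃ λ (t : Torus n) →
    ∀ K → Plücker W K ≈ c * (weight (coord t) K * Plücker X K)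
  Plücker-orbit {k} {n} {X} {W} (t , _ , back) = det S , t , λ K → begin
      Plücker W K
        ≈⟨ minors-cong {A = matrix W} {B = matrix (translate t X) ⊙ S} factor K ⟩
      minors (matrix (translate t X) ⊙ S) K
        ≈⟨ minors-⊙ (matrix (translate t X)) S K ⟩
      Plücker (translate t X) K * det S
        ≈⟨ C.*-comm _ (det S) ⟩
      det S * Plücker (translate t X) K
        ≈⟨ C.*-congˡ {x = det S} (Plücker-translate t X K) ⟩
      det S * (weight (coord t) K * Plücker X K) ∎
    where
    source : ∀ j → ∃ λ v → v ∈ ⟨ X ⟩ × (∀ i → matrix W i j ≈ coord t i * v i)
    source j = back (λ i → matrix W i j) ((λ p → δ p j) , λ i → C.sym (sum-δ (matrix W i) j))

    S : G.Matrix k k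
    S p j = proj₁ (proj₁ (proj₂ (source j))) p

    factor : ∀ i j → matrix W i j ≈ (matrix (translate t X) ⊙ S) i j
    factor i j = let v , (c , v≈Xc) , w≈tv = source j in C.trans (w≈tv i)
      (C.trans (C.*-congˡ {x = coord t i} (v≈Xc i)) (scale-· (coord t) (matrix X) c i))

  VanishesOnOrbit : Poly (k ⊑ n) → Gr k n → Set
  VanishesOnOrbit F X = ∀ W → W ∈ Orbit X → ⟦ F ⟧ (Plücker W) ≈ 0#

  -- Homogeneity enters here: vanishing of F does not depend on the scaling of the Plücker vector.
  vanishes-multiple : ∀ {d} (F : Poly (k ⊑ n)) → Homogeneous d F → ∀ {x y} → ⟦ F ⟧ x ≈ 0# →
    ∀ c → (∀ K → y K ≈ c * x K) → ⟦ F ⟧ y ≈ 0#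
  vanishes-multiple {d = d} F hom {x} {y} Fx≈0 c y≈cx = begin
    ⟦ F ⟧ y                 ≈⟨ ⟦⟧-cong F y≈cx ⟩
    ⟦ F ⟧ (λ K → c * x K)   ≈⟨ ⟦⟧-homogeneous hom c x ⟩
    c ^ d * ⟦ F ⟧ x         ≈⟨ C.*-congˡ {x = c ^ d} Fx≈0 ⟩
    c ^ d * 0#              ≈⟨ C.zeroʳ (c ^ d) ⟩
    0#                      ∎

  vanishes-translate : ∀ (F : Poly (k ⊑ n)) X → VanishesOnOrbit F X → ∀ t →
    ⟦ F ⟧ (λ K → weight (coord t) K * Plücker X K) ≈ 0#
  vanishes-translate F X F≈0 t = C.trans
    (⟦⟧-cong F (λ K → C.sym (Plücker-translate t X K))) (F≈0 (translate t X) (translate∈Orbit t X))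

  closure-translate : ∀ {X Z : Gr k n} c (t : Torus n) →
    (∀ K → Plücker Z K ≈ c * (weight (coord t) K * Plücker X K)) → Z ∈ OrbitClosure X
  closure-translate {X = X} c t e d F hom F≈0 = vanishes-multiple F hom (vanishes-translate F X F≈0 t) c e

  closure-proportional : ∀ {S : Pred (Gr k n) _} {Z Z′ : Gr k n} → Z ∈ Closure S → ∀ c →
    (∀ K → Plücker Z′ K ≈ c * Plücker Z K) → Z′ ∈ Closure S
  closure-proportional Z∈S c e d F hom F≈0 = vanishes-multiple F hom (Z∈S d F hom F≈0) c e

  -- The coordinate P^K is itself a form of degree 1, and on the orbit it takes only multiples of
  -- its value at X.
  closure-vanishing : ∀ {X Z : Gr k n} → Z ∈ OrbitClosure X → ∀ K → Plücker X K ≈ 0# → Plücker Z K ≈ 0#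
  closure-vanishing {X = X} Z∈X K XK≈0 = Z∈X 1 (var K) (var K) λ W W∈ →
    let c , t , e = Plücker-orbit {X = X} {W} W∈ in
    C.trans (e K) (C.trans (C.*-congˡ {x = c} (C.trans (C.*-congˡ {x = weight (coord t) K} XK≈0) (C.zeroʳ (weight (coord t) K)))) (C.zeroʳ c))

  -- F vanishes on tY as soon as F(t ·) vanishes on Y.
  closure-transitive : ∀ {X Y : Gr k n} → Y ∈ OrbitClosure X → ∀ Z → Z ∈ OrbitClosure Y → Z ∈ OrbitClosure X
  closure-transitive {k} {n} {X} {Y} Y∈X Z Z∈Y d F hom F≈0 = Z∈Y d F hom λ W W∈ →
    let c , t , e = Plücker-orbit {X = Y} {W} W∈
        σ = λ K → con (weight (coord t) K) ⊗ var K
    in vanishes-multiple F hom (C.trans (C.reflexive (≡.sym (⟦bind⟧ F σ (Plücker Y))))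
         -- Scaling the variables by the characters of t preserves the degree, and the scaled form
         -- vanishes on the orbit of X because the product of t and t′ is again a torus element.
         (Y∈X d (bind F σ) (bind-homogeneous hom (λ K → con _ ⊗ var K)) λ W′ W′∈ →
           let c′ , t′ , e′ = Plücker-orbit {X = X} {W′} W′∈ in
           C.trans (C.reflexive (⟦bind⟧ F σ (Plücker W′)))
             (vanishes-multiple F hom (vanishes-translate F X F≈0 (*-torus t t′)) c′ λ K → begin
               weight (coord t) K * Plücker W′ K
                 ≈⟨ C.*-congˡ {x = weight (coord t) K} (e′ K) ⟩
               weight (coord t) K * (c′ * (weight (coord t′) K * Plücker X K))
                 ≈⟨ solve 4 (λ w c v x → w :* (c :* (v :* x)) := c :* (w :* v :* x)) C.refl
                      (weight (coord t) K) c′ (weight (coord t′) K) (Plücker X K) ⟩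
               c′ * (weight (coord t) K * weight (coord t′) K * Plücker X K)
                 ≈⟨ C.*-congˡ {x = c′} (C.*-congʳ {x = Plücker X K} (weight-* (coord t) (coord t′) K)) ⟨
               c′ * (weight (coord (*-torus t t′)) K * Plücker X K) ∎)))
       c e

-- Affine charts of the Grassmannian.

module Charts (ℝ : CompleteOrderedField) where

  open Grassmannian ℝ hiding (sum-δ; δ; det; Matrix; sum-0)
  private module G = Grassmannian ℝ
  open ComplexField ℝ
  open PolynomialExpressions ℝ
  open OrbitClosures ℝ
  private module C = CommutativeRing ℂ-commutativeRing
  open LinearAlgebra ℂ-decidableField
    using (det; δ; δ-refl; sum-δ; sum-δˡ; _⊙_; kernel-or-minor; normalise; alternating-kernel; det-isAlternating; sum-single)
  open Sum C.semiring using (sum-cong-≋)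
  open SetoidReasoning C.setoid

  private variable
    k n : ℕ

  *-nonzero : ∀ {x y} → ¬ x ≈ 0# → ¬ y ≈ 0# → ¬ x * y ≈ 0#
  *-nonzero x≉0 y≉0 xy≈0 = y≉0 (x*y≈0⇒y≈0 x≉0 xy≈0)

  nonzeroˡ : ∀ {x y} → ¬ x * y ≈ 0# → ¬ x ≈ 0#
  nonzeroˡ {x} {y} xy≉0 x≈0 = xy≉0 (C.trans (C.*-congʳ {x = y} x≈0) (C.zeroˡ y))

  nonzeroʳ : ∀ {x y} → ¬ x * y ≈ 0# → ¬ y ≈ 0#
  nonzeroʳ {x} {y} xy≉0 y≈0 = xy≉0 (C.trans (C.*-congˡ {x = x} y≈0) (C.zeroʳ x))

  dependent-minors : ∀ (A : G.Matrix n k) c → (∀ i → sum (λ j → A i j * c j) ≈ 0#) → ∀ {j} → ¬ c j ≈ 0# →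
                     ∀ K → minors A K ≈ 0#
  dependent-minors A c Ac≈0 {j} cj≉0 K = decidable-stable (minors A K ≟ 0#) λ AK≉0 →
    cj≉0 (alternating-kernel det-isAlternating (A ∘ elem K)
      (λ e → AK≉0 (C.trans (det≈ (A ∘ elem K)) e)) c (Ac≈0 ∘ elem K) j)

  independent-minor : ∀ (A : G.Matrix n k) →
    (∀ c → (∀ i → sum (λ j → A i j * c j) ≈ 0#) → ∀ j → c j ≈ 0#) →
    ∃ λ (K : k ⊑ n) → ¬ minors A K ≈ 0#
  independent-minor {n} {k} A ind with kernel-or-minor k n A
  ... | inj₁ (c , (j , cj≉0) , Ac≈0) = contradiction (ind c Ac≈0 j) cj≉0
  ... | inj₂ (K , AK≉0) = K , λ e → AK≉0 (C.trans (C.sym (det≈ (A ∘ elem K))) e)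

  chartMatrix-coelem : ∀ (J : k ⊑ n) a q j → chartMatrix J a (coelem J q) j ≡ a (q , j)
  chartMatrix-coelem J a q j rewrite position-coelem J q = ≡.refl

  chartMatrix-unique : ∀ (J : k ⊑ n) a (M : G.Matrix n k) →
    (∀ p j → M (elem J p) j ≈ δ p j) → (∀ q j → M (coelem J q) j ≈ a (q , j)) →
    ∀ i j → M i j ≈ chartMatrix J a i j
  chartMatrix-unique J a M e f i j with position J i | at-position J i
  ... | inj₁ p | ≡.refl = e p j
  ... | inj₂ q | ≡.refl = f q j

  -- A change of basis turns the rows in J into the identity; l is its determinant, which is P^J(X).
  chart-of : ∀ (X : Gr k n) J → ¬ Plücker X J ≈ 0# →
    ∃ λ a → ∃ λ l → ∀ K → Plücker X K ≈ Plücker (chart J a) K * l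
  chart-of {k} {n} X J XJ≉0 = a , det (matrix X ∘ elem J) , λ K → begin
      Plücker X K
        ≈⟨ minors-cong {A = matrix X} {B = chartMatrix J a ⊙ (matrix X ∘ elem J)} factor K ⟩
      minors (chartMatrix J a ⊙ (matrix X ∘ elem J)) K
        ≈⟨ minors-⊙ (chartMatrix J a) (matrix X ∘ elem J) K ⟩
      Plücker (chart J a) K * det (matrix X ∘ elem J) ∎
    where
    normal = normalise (matrix X) (elem J) (λ e → XJ≉0 (C.trans (det≈ (matrix X ∘ elem J)) e))

    N : G.Matrix n k
    N = proj₁ normal

    a : Coord J → ℂ
    a (q , j) = N (coelem J q) j

    factor : ∀ i j → matrix X i j ≈ (chartMatrix J a ⊙ (matrix X ∘ elem J)) i j
    factor i j = C.trans (proj₁ (proj₂ normal) i j)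
      (sum-cong-≋ (λ p → C.*-congʳ {x = matrix X (elem J p) j}
        (chartMatrix-unique J a N (proj₂ (proj₂ normal)) (λ _ _ → C.refl) i p)))

  entry : ∀ (J : k ⊑ n) → Fin n → Fin k → Poly (Coord J)
  entry J i j = [ (λ p → con (δ p j)) , (λ q → var (q , j)) ]′ (position J i)

  ⟦entry⟧ : ∀ (J : k ⊑ n) i j x → ⟦ entry J i j ⟧ x ≡ chartMatrix J x i j
  ⟦entry⟧ J i j x with position J i
  ... | inj₁ p = ≡.refl
  ... | inj₂ q = ≡.refl

  chartMinor : ∀ (J K : k ⊑ n) → Poly (Coord J)
  chartMinor J K = polyDet λ p j → entry J (elem K p) j

  ⟦chartMinor⟧ : ∀ (J K : k ⊑ n) x → ⟦ chartMinor J K ⟧ x ≈ Plücker (chart J x) K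
  ⟦chartMinor⟧ J K x = C.trans (⟦polyDet⟧ (λ p j → entry J (elem K p) j) x)
    (minors-cong {A = λ i j → ⟦ entry J i j ⟧ x} {B = chartMatrix J x} (λ i j → C.reflexive (⟦entry⟧ J i j x)) K)

  -- Dehomogenisation: it carries the forms that test membership in a closure to polynomials in the
  -- affine coordinates.
  onChart : ∀ (J : k ⊑ n) → Poly (k ⊑ n) → Poly (Coord J)
  onChart J F = bind F (chartMinor J)

  ⟦onChart⟧ : ∀ (J : k ⊑ n) F x → ⟦ onChart J F ⟧ x ≈ ⟦ F ⟧ (Plücker (chart J x))
  ⟦onChart⟧ J F x = C.trans (C.reflexive (⟦bind⟧ F (chartMinor J) x)) (⟦⟧-cong F λ K → ⟦chartMinor⟧ J K x)

  module _ (J : k ⊑ n) (r : Vector ℂ (codim J)) (w w⁻¹ : Vector ℂ k)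
    (r≉0 : ∀ q → ¬ r q ≈ 0#) (ww⁻¹≈1 : ∀ p → w p * w⁻¹ p ≈ 1#) where

    chartTorus : Torus n
    chartTorus = record
      { coord   = λ i → [ w⁻¹ , r ]′ (position J i)
      ; nonzero = λ i → nz (position J i)
      }
      where
      nz : ∀ z → ¬ [ w⁻¹ , r ]′ z ≈ 0#
      nz (inj₁ p) e = 0≉1 (C.trans (C.sym (C.trans (C.*-congˡ {x = w p} e) (C.zeroʳ (w p)))) (ww⁻¹≈1 p))
      nz (inj₂ q) = r≉0 q

    diagonal : G.Matrix k k
    diagonal p j = w p * δ p j

    -- The torus element multiplies the rows in J by w⁻¹, so the columns must be multiplied by w to
    -- restore the identity there. The entry (q , j) is thereby scaled by r q and w j, and the
    -- change of basis contributes the determinant of `diagonal`.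
    chart-scale : ∀ (a : Coord J → ℂ) K → Plücker (chart J λ (q , j) → r q * a (q , j) * w j) K
      ≈ weight (coord chartTorus) K * Plücker (chart J a) K * det diagonal
    chart-scale a K = begin
      Plücker (chart J x) K
        ≈⟨ minors-cong {A = chartMatrix J x} {B = matrix (translate chartTorus (chart J a)) ⊙ diagonal} scaled K ⟩
      minors (matrix (translate chartTorus (chart J a)) ⊙ diagonal) K
        ≈⟨ minors-⊙ (matrix (translate chartTorus (chart J a))) diagonal K ⟩
      Plücker (translate chartTorus (chart J a)) K * det diagonal
        ≈⟨ C.*-congʳ {x = det diagonal} (Plücker-translate chartTorus (chart J a) K) ⟩
      weight (coord chartTorus) K * Plücker (chart J a) K * det diagonal ∎
      where
      x : Coord J → ℂ
      x (q , j) = r q * a (q , j) * w j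

      t = coord chartTorus

      entries : ∀ i j → chartMatrix J x i j ≈ t i * chartMatrix J a i j * w j
      entries i j with position J i
      ... | inj₂ q = C.refl
      ... | inj₁ p with p ≟ᶠ j
      ...   | yes ≡.refl = C.sym (C.trans (C.*-congʳ {x = w p} (C.*-identityʳ (w⁻¹ p)))
                             (C.trans (C.*-comm (w⁻¹ p) (w p)) (ww⁻¹≈1 p)))
      ...   | no p≢j = C.sym (C.trans (C.*-congʳ {x = w j} (C.zeroʳ (w⁻¹ p))) (C.zeroˡ (w j)))

      scaled : ∀ i j → chartMatrix J x i j ≈ (matrix (translate chartTorus (chart J a)) ⊙ diagonal) i j
      scaled i j = begin
        chartMatrix J x i j
          ≈⟨ entries i j ⟩
        t i * chartMatrix J a i j * w j
          ≈⟨ sum-δ (λ p → t i * chartMatrix J a i p * w p) j ⟨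
        sum (λ p → t i * chartMatrix J a i p * w p * δ p j)
          ≈⟨ sum-cong-≋ (λ p → C.*-assoc (t i * chartMatrix J a i p) (w p) (δ p j)) ⟩
        sum (λ p → t i * chartMatrix J a i p * (w p * δ p j)) ∎

  -- For v = (q , j), keep only the rows of the chart matrix of x that belong to
  -- J without its j-th element or are the q-th row outside J.  The columns stay
  -- independent, so x has a nonzero minor K on these rows, and so has a.  If
  -- a v were 0, the j-th column of that minor of a would vanish.
  support-⊆ : ∀ (J : k ⊑ n) x a →
    (∀ K → ¬ Plücker (chart J x) K ≈ 0# → ¬ Plücker (chart J a) K ≈ 0#) →
    ∀ v → ¬ x v ≈ 0# → ¬ a v ≈ 0#
  support-⊆ {k} {n} J x a minors⊆ (q , j) xv≉0 av≈0 = masked-a≉0 (dependent-minors masked-a (λ p → δ p j) zero-column {j} (λ e → 0≉1 (C.trans (C.sym e) (δ-refl j))) K)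
    where
    -- Rows are multiplied by 0 or 1 instead of being deleted, so that minors are still indexed by
    -- k-element subsets of Fin n.
    mask : Fin k ⊎ Fin (codim J) → ℂ
    mask (inj₁ p)  = if does (p ≟ᶠ j) then 0# else 1#
    mask (inj₂ q′) = δ q q′

    t : Fin n → ℂ
    t i = mask (position J i)

    masked-x masked-a : G.Matrix n k
    masked-x i p = t i * chartMatrix J x i p
    masked-a i p = t i * chartMatrix J a i p

    mask-≢ : ∀ {p} → p ≢ j → mask (inj₁ p) ≡ 1#
    mask-≢ {p} p≢j rewrite dec-false (p ≟ᶠ j) p≢j = ≡.refl

    independent-x : ∀ c → (∀ i → sum (λ p → masked-x i p * c p) ≈ 0#) → ∀ p → c p ≈ 0#
    independent-x c e = zeros
      where
      away : ∀ p → p ≢ j → c p ≈ 0#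
      away p p≢j = begin
        c p
          ≈⟨ sum-δˡ c p ⟨
        sum (λ l → δ p l * c l)
          ≈⟨ sum-cong-≋ (λ l → C.*-congʳ {x = c l} (C.sym (C.trans
               (C.reflexive (≡.cong₂ _*_ (≡.trans (≡.cong mask (position-elem J p)) (mask-≢ p≢j)) (chartMatrix-elem J x p l)))
               (C.*-identityˡ (δ p l))))) ⟩
        sum (λ l → masked-x (elem J p) l * c l)
          ≈⟨ e (elem J p) ⟩
        0# ∎

      at : c j ≈ 0#
      at = x*y≈0⇒y≈0 xv≉0 (begin
        x (q , j) * c j
          ≈⟨ C.*-congʳ {x = c j} (C.trans (C.*-congʳ {x = x (q , j)} (δ-refl q)) (C.*-identityˡ (x (q , j)))) ⟨
        δ q q * x (q , j) * c j
          ≡⟨ ≡.cong (_* c j) (≡.cong₂ _*_ (≡.cong mask (position-coelem J q)) (chartMatrix-coelem J x q j)) ⟨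
        masked-x (coelem J q) j * c j
          ≈⟨ sum-single (λ p → masked-x (coelem J q) p * c p) j (λ p p≢j →
               C.trans (C.*-congˡ {x = masked-x (coelem J q) p} (away p p≢j)) (C.zeroʳ (masked-x (coelem J q) p))) ⟨
        sum (λ p → masked-x (coelem J q) p * c p)
          ≈⟨ e (coelem J q) ⟩
        0# ∎)

      zeros : ∀ p → c p ≈ 0#
      zeros p with p ≟ᶠ j
      ... | yes ≡.refl = at
      ... | no p≢j = away p p≢j

    K : k ⊑ n
    K = proj₁ (independent-minor masked-x independent-x)

    scaled-x≉0 : ¬ weight t K * Plücker (chart J x) K ≈ 0#
    scaled-x≉0 e = proj₂ (independent-minor masked-x independent-x)
      (C.trans (minors-scale t (chartMatrix J x) K) e)

    -- The factor `weight t K` is nonzero because K uses kept rows only; it is the same for both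
    -- masked matrices.
    masked-a≉0 : ¬ minors masked-a K ≈ 0#
    masked-a≉0 e = *-nonzero (nonzeroˡ scaled-x≉0) (minors⊆ K (nonzeroʳ scaled-x≉0))
      (C.trans (C.sym (minors-scale t (chartMatrix J a) K)) e)

    zero-entry : ∀ i → masked-a i j ≈ 0#
    zero-entry i with position J i
    ... | inj₁ p with p ≟ᶠ j
    ...   | yes _ = C.zeroˡ 1#
    ...   | no _ = C.zeroʳ 1#
    zero-entry i | inj₂ q′ with q ≟ᶠ q′
    ...   | yes ≡.refl = C.trans (C.*-congˡ {x = 1#} av≈0) (C.zeroʳ 1#)
    ...   | no _ = C.zeroˡ (a (q′ , j))

    zero-column : ∀ i → sum (λ p → masked-a i p * δ p j) ≈ 0#
    zero-column i = C.trans (sum-δ (masked-a i) j) (zero-entry i)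

-- Smoothness at the torus-fixed point of a chart.

module SmoothOrbitClosures (ℝ : CompleteOrderedField) where

  open Grassmannian ℝ hiding (sum-δ; δ; det; Matrix; sum-0)
  open ComplexField ℝ using (_≟_; 0≉1; inverse; 2≉0; ℂ-decidableField)
  open PolynomialExpressions ℝ
  open OrbitClosures ℝ
  open Charts ℝ
  private module C = CommutativeRing ℂ-commutativeRing
  open LinearAlgebra ℂ-decidableField
    using (det; δ; δ-refl; sum-δˡ; sum-0)
  open Sum C.semiring using (sum-cong-≋; *-distribˡ-sum; ∑-distrib-+)
  open SemiringSolver C.commutativeSemiring using (solve; _:=_; _:+_; _:*_) renaming (con to :con)
  open GroupProperties C.+-group using (x∙y⁻¹≈ε⇒x≈y)
  open RingProperties C.ring using (-‿distribˡ-*; -‿distribʳ-*)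
  open SetoidReasoning C.setoid

  module _ {k n} (X : Gr k n) (J : k ⊑ n) (XJ≉0 : ¬ Plücker X J ≈ 0#)
    (a : Coord J → ℂ) (l : ℂ) (X≈a : ∀ K → Plücker X K ≈ Plücker (chart J a) K * l) where

    _≟ⱽ_ = _≟ᶜ_ {J = J}

    a≈X : ∃ λ m → ∀ K → Plücker (chart J a) K ≈ m * Plücker X K
    a≈X = let m , lm≈1 = inverse l (nonzeroʳ (λ e → XJ≉0 (C.trans (X≈a J) e))) in m , λ K → begin
      Plücker (chart J a) K
        ≈⟨ C.*-identityʳ (Plücker (chart J a) K) ⟨
      Plücker (chart J a) K * 1#
        ≈⟨ C.*-congˡ {x = Plücker (chart J a) K} lm≈1 ⟨
      Plücker (chart J a) K * (l * m)
        ≈⟨ solve 3 (λ p l m → p :* (l :* m) := m :* (p :* l)) C.refl (Plücker (chart J a) K) l m ⟩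
      m * (Plücker (chart J a) K * l)
        ≈⟨ C.*-congˡ {x = m} (X≈a K) ⟨
      m * Plücker X K ∎

    scale∈closure : ∀ (r : Vector ℂ (codim J)) (w : Vector ℂ k) → (∀ q → ¬ r q ≈ 0#) → (∀ p → ¬ w p ≈ 0#) →
      chart J (λ (q , j) → r q * a (q , j) * w j) ∈ OrbitClosure X
    scale∈closure r w r≉0 w≉0 = closure-translate {X = X} {Z = chart J (λ (q , j) → r q * a (q , j) * w j)}
      (det D * m) t λ K → begin
        Plücker (chart J (λ (q , j) → r q * a (q , j) * w j)) K
          ≈⟨ chart-scale J r w w⁻¹ r≉0 ww⁻¹≈1 a K ⟩
        weight (coord t) K * Plücker (chart J a) K * det D
          ≈⟨ C.*-congʳ {x = det D} (C.*-congˡ {x = weight (coord t) K} (proj₂ a≈X K)) ⟩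
        weight (coord t) K * (m * Plücker X K) * det D
          ≈⟨ solve 4 (λ t m x d → t :* (m :* x) :* d := d :* m :* (t :* x)) C.refl
               (weight (coord t) K) m (Plücker X K) (det D) ⟩
        det D * m * (weight (coord t) K * Plücker X K) ∎
      where
      m = proj₁ a≈X
      w⁻¹ : Vector ℂ k
      w⁻¹ p = proj₁ (inverse (w p) (w≉0 p))
      ww⁻¹≈1 : ∀ p → w p * w⁻¹ p ≈ 1#
      ww⁻¹≈1 p = proj₂ (inverse (w p) (w≉0 p))
      t = chartTorus J r w w⁻¹ r≉0 ww⁻¹≈1
      D = diagonal J r w w⁻¹ r≉0 ww⁻¹≈1

    I : Pred (Poly (Coord J)) _
    I = Ideal (OrbitClosure X) J

    -- The scalar s is absorbed into the row scaling r: the line from the origin through a translate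
    -- of a stays in the orbit for s ≠ 0. Constant and linear coefficients of f can therefore be
    -- read off along it.
    ideal-scale : ∀ {f} → f ∈ I → ∀ (r : Vector ℂ (codim J)) (w : Vector ℂ k) → (∀ q → ¬ r q ≈ 0#) → (∀ p → ¬ w p ≈ 0#) →
      ∀ s → ¬ s ≈ 0# → ⟦ f ⟧ (λ v → s * (r (proj₁ v) * a v * w (proj₂ v))) ≈ 0#
    ideal-scale {f} f∈I r w r≉0 w≉0 s s≉0 = C.trans
      (⟦⟧-cong f λ v → solve 4 (λ s r a w → s :* (r :* a :* w) := s :* r :* a :* w) C.refl s (r (proj₁ v)) (a v) (w (proj₂ v)))
      (f∈I _ (scale∈closure (λ q → s * r q) w (λ q → *-nonzero s≉0 (r≉0 q)) w≉0))

    one : ∀ {m} → Vector ℂ m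
    one _ = 1#

    one≉0 : ∀ {m} (i : Fin m) → ¬ one i ≈ 0#
    one≉0 _ e = 0≉1 (C.sym e)

    ideal-origin : ∀ {f} → f ∈ I → ⟦ f ⟧ origin ≈ 0#
    ideal-origin {f} f∈I = vanishing-at-origin f (λ v → 1# * a v * 1#)
      (ideal-scale {f} f∈I one one one≉0 one≉0)

    -- The origin of the chart, the coordinate subspace of J, is the limit of s a as s tends to 0.
    origin∈closure : chart J origin ∈ OrbitClosure X
    origin∈closure d F hom F≈0 = C.trans (C.sym (⟦onChart⟧ J F origin)) (ideal-origin {onChart J F}
      λ x x∈ → C.trans (⟦onChart⟧ J F x) (x∈ d F hom F≈0))

    bump : ∀ {m} → Fin m → Vector ℂ m
    bump i j = 1# + δ i j

    bump≉0 : ∀ {m} (i j : Fin m) → ¬ bump i j ≈ 0#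
    bump≉0 i j with i ≟ᶠ j
    ... | yes _ = 2≉0
    ... | no _  = λ e → 0≉1 (C.trans (C.sym e) (C.+-identityʳ 1#))

    -- The coordinates have distinct weights under the torus, so a polynomial
    -- in the ideal has no linear term in a coordinate that is nonzero on X.
    -- The weights are separated by doubling row q and column j: the inclusion-
    -- exclusion of the four resulting points is supported on the entry (q , j).
    ideal-∂ : ∀ {f} → f ∈ I → ∀ v → ¬ a v ≈ 0# → ⟦ ∂ _≟ⱽ_ v f ⟧ origin ≈ 0#
    ideal-∂ {f} f∈I v@(q , j) av≉0 = x*y≈0⇒y≈0 av≉0 (begin
      a v * ⟦ ∂ _≟ⱽ_ v f ⟧ origin
        ≈⟨ C.*-comm (a v) (⟦ ∂ _≟ⱽ_ v f ⟧ origin) ⟩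
      ⟦ ∂ _≟ⱽ_ v f ⟧ origin * a v
        ≡⟨ ≡.cong (_* a v) (differential-basis _≟ⱽ_ v f) ⟨
      differential f (basis _≟ⱽ_ v) * a v
        ≈⟨ differential-* f (basis _≟ⱽ_ v) (a v) ⟨
      differential f (λ u → basis _≟ⱽ_ v u * a v)
        ≈⟨ differential-cong f single ⟨
      differential f (point (δ q) (δ j))
        ≈⟨ C.+-identityʳ (differential f (point (δ q) (δ j))) ⟨
      differential f (point (δ q) (δ j)) + 0#
        ≈⟨ C.+-congˡ {x = differential f (point (δ q) (δ j))} (zero-at (bump q) one (bump≉0 q) one≉0) ⟨
      differential f (point (δ q) (δ j)) + differential f (point (bump q) one)
        ≈⟨ differential-+ f (point (δ q) (δ j)) (point (bump q) one) ⟨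
      differential f (λ u → point (δ q) (δ j) u + point (bump q) one u)
        ≈⟨ C.+-identityʳ _ ⟨
      differential f (λ u → point (δ q) (δ j) u + point (bump q) one u) + 0#
        ≈⟨ C.+-congˡ {x = differential f (λ u → point (δ q) (δ j) u + point (bump q) one u)} (zero-at one (bump j) one≉0 (bump≉0 j)) ⟨
      differential f (λ u → point (δ q) (δ j) u + point (bump q) one u) + differential f (point one (bump j))
        ≈⟨ differential-+ f (λ u → point (δ q) (δ j) u + point (bump q) one u) (point one (bump j)) ⟨
      differential f (λ u → point (δ q) (δ j) u + point (bump q) one u + point one (bump j) u)
        -- This is d e = (1 + d)(1 + e) - (1 + d) - (1 + e) + 1 times a, with the negative terms
        -- moved across to make it an identity of semirings.
        ≈⟨ differential-cong f (λ u → solve 3 (λ d a e →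
             d :* a :* e :+ (:con 1 :+ d) :* a :* :con 1 :+ :con 1 :* a :* (:con 1 :+ e)
             := (:con 1 :+ d) :* a :* (:con 1 :+ e) :+ :con 1 :* a :* :con 1) C.refl (δ q (proj₁ u)) (a u) (δ j (proj₂ u))) ⟩
      differential f (λ u → point (bump q) (bump j) u + point one one u)
        ≈⟨ differential-+ f (point (bump q) (bump j)) (point one one) ⟩
      differential f (point (bump q) (bump j)) + differential f (point one one)
        ≈⟨ C.+-cong (zero-at (bump q) (bump j) (bump≉0 q) (bump≉0 j)) (zero-at one one one≉0 one≉0) ⟩
      0# + 0#
        ≈⟨ C.+-identityˡ 0# ⟩
      0# ∎)
      where
      point : Vector ℂ (codim J) → Vector ℂ k → Coord J → ℂ
      point r w (q , j) = r q * a (q , j) * w j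

      zero-at : ∀ r w → (∀ q → ¬ r q ≈ 0#) → (∀ p → ¬ w p ≈ 0#) → differential f (point r w) ≈ 0#
      zero-at r w r≉0 w≉0 = vanishing-differential f (point r w) (ideal-scale {f} f∈I r w r≉0 w≉0)

      single : ∀ u → point (δ q) (δ j) u ≈ basis _≟ⱽ_ v u * a v
      single u@(q′ , j′) with v ≟ⱽ u
      ... | yes ≡.refl = C.trans (C.*-cong (C.*-congʳ {x = a v} (δ-refl q)) (δ-refl j)) (C.*-identityʳ (1# * a v))
      ... | no v≢u with q ≟ᶠ q′ | j ≟ᶠ j′
      ...   | yes ≡.refl | yes ≡.refl = contradiction ≡.refl v≢u
      ...   | yes _ | no _ = C.trans (C.zeroʳ (1# * a u)) (C.sym (C.zeroˡ (a v)))
      ...   | no _ | e = C.trans (C.*-congʳ (C.zeroˡ (a u))) (C.trans (C.zeroˡ _) (C.sym (C.zeroˡ (a v))))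

    -- Points of the closure have nonzero minors only where X does, so by `support-⊆` their
    -- coordinates are nonzero only where those of X are.
    coordinate∈I : ∀ v → a v ≈ 0# → var v ∈ I
    coordinate∈I v av≈0 x x∈ = decidable-stable (x v ≟ 0#) λ xv≉0 →
      support-⊆ J x a (λ K xK≉0 aK≈0 → xK≉0 (closure-vanishing {X = X} {chart J x} x∈ K
        (C.trans (X≈a K) (C.trans (C.*-congʳ {x = l} aK≈0) (C.zeroˡ l))))) v xv≉0 av≈0

    module _ (smooth : SmoothAt (OrbitClosure X) J origin) where

      m = proj₁ smooth

      f : Fin m → Poly (Coord J)
      f = proj₁ (proj₂ smooth)

      f∈I : ∀ r → f r ∈ I
      f∈I = proj₁ (proj₁ (proj₂ (proj₂ smooth)))

      generate : ∀ h → h ∈ I → ∃ λ g → ¬ (⟦ g ⟧ origin ≈ 0#) ×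
        ∃ λ (q : Fin m → Poly (Coord J)) → ∀ x → ⟦ g ⟧ x * ⟦ h ⟧ x ≈ sum λ r → ⟦ q r ⟧ x * ⟦ f r ⟧ x
      generate = proj₂ (proj₁ (proj₂ (proj₂ smooth)))

      full-rank : FullRankJacobian _≟ⱽ_ origin f
      full-rank = proj₂ (proj₂ (proj₂ smooth))

      module _ (v : Coord J) (av≈0 : a v ≈ 0#) where

        private generated = generate (var v) (coordinate∈I v av≈0)

        denominator : Poly (Coord J)
        denominator = proj₁ generated

        denominator≉0 : ¬ ⟦ denominator ⟧ origin ≈ 0#
        denominator≉0 = proj₁ (proj₂ generated)

        coefficient : Fin m → Poly (Coord J)
        coefficient = proj₁ (proj₂ (proj₂ generated))

        coordinate-generated : ∀ x → ⟦ denominator ⟧ x * x v ≈ sum λ r → ⟦ coefficient r ⟧ x * ⟦ f r ⟧ x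
        coordinate-generated = proj₂ (proj₂ (proj₂ generated))

        -- The Leibniz rule applied to g x_v = Σ q_r f_r. Since x_v and all f_r vanish at the
        -- origin, the derivatives of g and of the q_r drop out.
        differential-generated : ∀ y →
          ⟦ denominator ⟧ origin * y v ≈ sum λ r → ⟦ coefficient r ⟧ origin * differential (f r) y
        differential-generated y = begin
          ⟦ denominator ⟧ origin * y v
            ≈⟨ C.trans (C.+-congʳ {x = ⟦ denominator ⟧ origin * y v} (C.zeroʳ (differential denominator y))) (C.+-identityˡ _) ⟨
          differential (denominator ⊗ var v) y
            ≈⟨ differential-≗ (denominator ⊗ var v) (polySum (λ r → coefficient r ⊗ f r))
                 (λ x → C.trans (coordinate-generated x) (C.reflexive (≡.sym (⟦polySum⟧ (λ r → coefficient r ⊗ f r) x)))) y ⟩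
          differential (polySum (λ r → coefficient r ⊗ f r)) y
            ≡⟨ differential-polySum (λ r → coefficient r ⊗ f r) y ⟩
          sum (λ r → differential (coefficient r) y * ⟦ f r ⟧ origin + ⟦ coefficient r ⟧ origin * differential (f r) y)
            ≈⟨ sum-cong-≋ (λ r → C.trans (C.+-congʳ {x = ⟦ coefficient r ⟧ origin * differential (f r) y}
                 (C.trans (C.*-congˡ {x = differential (coefficient r) y} (ideal-origin {f r} (f∈I r))) (C.zeroʳ (differential (coefficient r) y))))
                 (C.+-identityˡ (⟦ coefficient r ⟧ origin * differential (f r) y))) ⟩
          sum (λ r → ⟦ coefficient r ⟧ origin * differential (f r) y) ∎

      -- A left inverse of the part of the Jacobian matrix with columns in the
      -- zero set of a; full rank makes it a right inverse.
      leftInverseRow : ∀ {v} → Dec (a v ≈ 0#) → Fin m → ℂ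
      leftInverseRow {v} (yes av≈0) s = proj₁ (inverse _ (denominator≉0 v av≈0)) * ⟦ coefficient v av≈0 s ⟧ origin
      leftInverseRow     (no _)     s = 0#

      leftInverse : Fin m → Coord J → ℂ
      leftInverse s v = leftInverseRow {v} (a v ≟ 0#) s

      -- The decision of a v ≈ 0# is a parameter, so that both shapes of the row reduce.
      leftInverseRow-combination : ∀ (c : Vector ℂ m) v y (v? : Dec (a v ≈ 0#)) →
        (∀ av≈0 → sum (λ s → ⟦ coefficient v av≈0 s ⟧ origin * c s) ≈ ⟦ denominator v av≈0 ⟧ origin * y) →
        (¬ a v ≈ 0# → y ≈ 0#) →
        sum (λ s → leftInverseRow {v} v? s * c s) ≈ y
      leftInverseRow-combination c v y (no av≉0) e e′ = C.trans (sum-0 (λ s → C.zeroˡ (c s))) (C.sym (e′ av≉0))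
      leftInverseRow-combination c v y (yes av≈0) e e′ = begin
        sum (λ s → g⁻¹ * q s * c s)
          ≈⟨ sum-cong-≋ (λ s → C.*-assoc g⁻¹ (q s) (c s)) ⟩
        sum (λ s → g⁻¹ * (q s * c s))
          ≈⟨ *-distribˡ-sum g⁻¹ (λ s → q s * c s) ⟨
        g⁻¹ * sum (λ s → q s * c s)
          ≈⟨ C.*-congˡ {x = g⁻¹} (e av≈0) ⟩
        g⁻¹ * (g * y)
          ≈⟨ solve 3 (λ i g y → i :* (g :* y) := g :* i :* y) C.refl g⁻¹ g y ⟩
        g * g⁻¹ * y
          ≈⟨ C.*-congʳ {x = y} (proj₂ (inverse g (denominator≉0 v av≈0))) ⟩
        1# * y
          ≈⟨ C.*-identityˡ y ⟩
        y ∎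
        where
        g g⁻¹ : ℂ
        g = ⟦ denominator v av≈0 ⟧ origin
        g⁻¹ = proj₁ (inverse g (denominator≉0 v av≈0))
        q : Vector ℂ m
        q s = ⟦ coefficient v av≈0 s ⟧ origin

      leftInverse-combination : ∀ (c : Vector ℂ m) v y →
        (∀ av≈0 → sum (λ s → ⟦ coefficient v av≈0 s ⟧ origin * c s) ≈ ⟦ denominator v av≈0 ⟧ origin * y) →
        (¬ a v ≈ 0# → y ≈ 0#) →
        sum (λ s → leftInverse s v * c s) ≈ y
      leftInverse-combination c v y = leftInverseRow-combination c v y (a v ≟ 0#)

      -- With D the Jacobian matrix and L = `leftInverse`, this is D L D = D. Column u of D vanishes
      -- if a u ≠ 0, by `ideal-∂`; otherwise `differential-generated` shows that L sends it to the
      -- basis vector of u.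
      ∂-combination : ∀ r u →
        sum (λ s → differential (f r) (leftInverse s) * ⟦ ∂ _≟ⱽ_ u (f s) ⟧ origin) ≈ ⟦ ∂ _≟ⱽ_ u (f r) ⟧ origin
      ∂-combination r u = begin
        sum (λ s → differential (f r) (leftInverse s) * d s)
          ≈⟨ differential-sum (f r) leftInverse d ⟨
        differential (f r) (λ v → sum λ s → leftInverse s v * d s)
          ≈⟨ by-support (a u ≟ 0#) ⟩
        d r ∎
        where
        d : Vector ℂ m
        d s = ⟦ ∂ _≟ⱽ_ u (f s) ⟧ origin

        by-support : Dec (a u ≈ 0#) → differential (f r) (λ v → sum λ s → leftInverse s v * d s) ≈ d r
        by-support (no au≉0) = C.trans (differential-0 (f r) λ v →
            sum-0 λ s → C.trans (C.*-congˡ {x = leftInverse s v} (ideal-∂ {f s} (f∈I s) u au≉0)) (C.zeroʳ (leftInverse s v)))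
          (C.sym (ideal-∂ {f r} (f∈I r) u au≉0))
        by-support (yes au≈0) = C.trans
          (differential-cong (f r) λ v → leftInverse-combination d v (basis _≟ⱽ_ u v)
            (λ av≈0 → C.trans
              (sum-cong-≋ (λ s → C.*-congˡ {x = ⟦ coefficient v av≈0 s ⟧ origin} (C.reflexive (≡.sym (differential-basis _≟ⱽ_ u (f s))))))
              (C.sym (differential-generated v av≈0 (basis _≟ⱽ_ u))))
            (λ av≉0 → off-diagonal v (λ { ≡.refl → av≉0 au≈0 })))
          (C.reflexive (differential-basis _≟ⱽ_ u (f r)))
          where
          off-diagonal : ∀ v → u ≢ v → basis _≟ⱽ_ u v ≈ 0#
          off-diagonal v u≢v rewrite dec-false (u ≟ⱽ v) u≢v = C.refl

      -- From D L D = D, row r of D L - 1 is a linear relation among the rows of D, and these are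
      -- independent by smoothness.
      rightInverse : ∀ r s → differential (f r) (leftInverse s) ≈ δ r s
      rightInverse r s = x∙y⁻¹≈ε⇒x≈y _ _ (full-rank (λ s → D s + - δ r s) (λ u → begin
        sum (λ s → (D s + - δ r s) * d u s)
          ≈⟨ sum-cong-≋ (λ s → C.trans (C.distribʳ (d u s) (D s) (- δ r s))
               (C.+-congˡ {x = D s * d u s} (C.trans (C.sym (-‿distribˡ-* (δ r s) (d u s))) (-‿distribʳ-* (δ r s) (d u s))))) ⟩
        sum (λ s → D s * d u s + δ r s * - d u s)
          ≈⟨ ∑-distrib-+ (λ s → D s * d u s) (λ s → δ r s * - d u s) ⟩
        sum (λ s → D s * d u s) + sum (λ s → δ r s * - d u s)
          ≈⟨ C.+-cong (∂-combination r u) (sum-δˡ (λ s → - d u s) r) ⟩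
        d u r + - d u r
          ≈⟨ C.-‿inverseʳ (d u r) ⟩
        0# ∎) s)
        where
        D : Vector ℂ m
        D s = differential (f r) (leftInverse s)
        d : Coord J → Vector ℂ m
        d u s = ⟦ ∂ _≟ⱽ_ u (f s) ⟧ origin

      -- Here c = D L c, and L c = 0 because the rows of L are zero or multiples of the given
      -- relations. This is the hypothesis on Q(0) in `nakayama`.
      coefficient-injective : ∀ (c : Vector ℂ m) →
        (∀ v (av≈0 : a v ≈ 0#) → sum (λ r → ⟦ coefficient v av≈0 r ⟧ origin * c r) ≈ 0#) →
        ∀ r → c r ≈ 0#
      coefficient-injective c e r = begin
        c r
          ≈⟨ sum-δˡ c r ⟨
        sum (λ s → δ r s * c s)
          ≈⟨ sum-cong-≋ (λ s → C.*-congʳ {x = c s} (rightInverse r s)) ⟨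
        sum (λ s → differential (f r) (leftInverse s) * c s)
          ≈⟨ differential-sum (f r) leftInverse c ⟨
        differential (f r) (λ v → sum λ s → leftInverse s v * c s)
          ≈⟨ differential-0 (f r) (λ v → leftInverse-combination c v 0#
               (λ av≈0 → C.trans (e v av≈0) (C.sym (C.zeroʳ (⟦ denominator v av≈0 ⟧ origin)))) (λ _ → C.refl)) ⟩
        0# ∎

      module _ (b : Coord J → ℂ) (support : ∀ v → a v ≈ 0# → b v ≈ 0#) where

        -- On the line through b every x_v with a v = 0 is identically zero, so g x_v = Σ q_r f_r
        -- turns into the system to which `nakayama` applies.
        generators-vanish : ∀ r s → ⟦ f r ⟧ (λ v → s * b v) ≈ 0#
        generators-vanish r s = C.trans (C.sym (eval-onLine (f r) b s)) (nakayama Q injective F combination r s)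
          where
          V = ∃ λ v → a v ≈ 0#

          Q : V → Fin m → List ℂ
          Q (v , av≈0) r = onLine (coefficient v av≈0 r) b

          F : Fin m → List ℂ
          F r = onLine (f r) b

          injective : ∀ c → (∀ v → sum (λ r → eval (Q v r) 0# * c r) ≈ 0#) → ∀ r → c r ≈ 0#
          injective c e = coefficient-injective c λ v av≈0 → C.trans
            (sum-cong-≋ (λ r → C.*-congʳ {x = c r} (C.sym (C.trans (eval-at-0 (Q (v , av≈0) r)) (coeff₀-onLine (coefficient v av≈0 r) b)))))
            (e (v , av≈0))

          combination : ∀ v s → sum (λ r → eval (Q v r) s * eval (F r) s) ≈ 0#
          combination (v , av≈0) s = begin
            sum (λ r → eval (Q (v , av≈0) r) s * eval (F r) s)
              ≈⟨ sum-cong-≋ (λ r → C.*-cong (eval-onLine (coefficient v av≈0 r) b s) (eval-onLine (f r) b s)) ⟩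
            sum (λ r → ⟦ coefficient v av≈0 r ⟧ (λ u → s * b u) * ⟦ f r ⟧ (λ u → s * b u))
              ≈⟨ coordinate-generated v av≈0 (λ u → s * b u) ⟨
            g * (s * b v)
              ≈⟨ C.*-congˡ {x = g} (C.trans (C.*-congˡ {x = s} (support v av≈0)) (C.zeroʳ s)) ⟩
            g * 0#
              ≈⟨ C.zeroʳ g ⟩
            0# ∎
            where g = ⟦ denominator v av≈0 ⟧ (λ u → s * b u)

        -- Some g with g(0) ≠ 0 makes g h a combination of the f_r, so g h = 0 along the line. The 1
        -- × 1 case of `nakayama` cancels g on the whole line; the value at s = 1 is h(b), although
        -- g(b) may be 0.
        ideal-vanishes : ∀ h → h ∈ I → ⟦ h ⟧ b ≈ 0#
        ideal-vanishes h h∈I = C.trans (⟦⟧-cong h (λ v → C.sym (C.*-identityˡ (b v))))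
          (C.trans (C.sym (eval-onLine h b 1#))
            (nakayama {V = ⊤} {m = 1} (λ _ _ → onLine g b) injective (λ _ → onLine h b) (λ _ → product-vanishes) zero 1#))
          where
          generated = generate h h∈I
          g = proj₁ generated
          q = proj₁ (proj₂ (proj₂ generated))

          injective : ∀ (c : Vector ℂ 1) → (⊤ → eval (onLine g b) 0# * c zero + 0# ≈ 0#) → ∀ r → c r ≈ 0#
          injective c e zero = x*y≈0⇒y≈0 (proj₁ (proj₂ generated)) (begin
            ⟦ g ⟧ origin * c zero
              ≈⟨ C.*-congʳ {x = c zero} (C.trans (eval-at-0 (onLine g b)) (coeff₀-onLine g b)) ⟨
            eval (onLine g b) 0# * c zero
              ≈⟨ C.+-identityʳ (eval (onLine g b) 0# * c zero) ⟨
            eval (onLine g b) 0# * c zero + 0#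
              ≈⟨ e tt ⟩
            0# ∎)

          product-vanishes : ∀ s → eval (onLine g b) s * eval (onLine h b) s + 0# ≈ 0#
          product-vanishes s = begin
            eval (onLine g b) s * eval (onLine h b) s + 0#
              ≈⟨ C.+-identityʳ (eval (onLine g b) s * eval (onLine h b) s) ⟩
            eval (onLine g b) s * eval (onLine h b) s
              ≈⟨ C.*-cong (eval-onLine g b s) (eval-onLine h b s) ⟩
            ⟦ g ⟧ x * ⟦ h ⟧ x
              ≈⟨ proj₂ (proj₂ (proj₂ generated)) x ⟩
            sum (λ r → ⟦ q r ⟧ x * ⟦ f r ⟧ x)
              ≈⟨ sum-0 (λ r → C.trans (C.*-congˡ {x = ⟦ q r ⟧ x} (generators-vanish r s)) (C.zeroʳ (⟦ q r ⟧ x))) ⟩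
            0# ∎
            where
            x : Coord J → ℂ
            x v = s * b v

        chart∈closure : chart J b ∈ OrbitClosure X
        chart∈closure d F hom F≈0 = C.trans (C.sym (⟦onChart⟧ J F b))
          (ideal-vanishes (onChart J F) λ x x∈ → C.trans (⟦onChart⟧ J F x) (x∈ d F hom F≈0))

  closure-⊆ : ∀ {k n} (X Y : Gr k n) → Smooth (OrbitClosure X) →
    (∀ K → ¬ Plücker X K ≈ 0# → ¬ Plücker Y K ≈ 0#) →
    (∀ K → ¬ Plücker Y K ≈ 0# → ¬ Plücker X K ≈ 0#) →
    ∀ Z → Z ∈ OrbitClosure Y → Z ∈ OrbitClosure X
  closure-⊆ X Y smooth X⊆Y Y⊆X =
    let J , XJ≉0 = independent-minor (matrix X) (independent X)
        a , l , X≈a = chart-of X J XJ≉0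
        b , m , Y≈b = chart-of Y J (X⊆Y J XJ≉0)
        minors⊆ : ∀ K → ¬ Plücker (chart J b) K ≈ 0# → ¬ Plücker (chart J a) K ≈ 0#
        minors⊆ = λ K bK≉0 → nonzeroˡ (λ e → Y⊆X K
          (λ e → *-nonzero bK≉0 (nonzeroʳ (λ e → X⊆Y J XJ≉0 (C.trans (Y≈b J) e))) (C.trans (C.sym (Y≈b K)) e))
          (C.trans (X≈a K) e))
        b∈X = chart∈closure X J XJ≉0 a l X≈a (smooth J origin (origin∈closure X J XJ≉0 a l X≈a)) b
          λ v av≈0 → decidable-stable (b v ≟ 0#) λ bv≉0 → support-⊆ J b a minors⊆ v bv≉0 av≈0
    in closure-transitive {X = X} {Y} (closure-proportional {Z = chart J b} {Y} b∈X m
         λ K → C.trans (Y≈b K) (C.*-comm (Plücker (chart J b) K) m))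

-- The moment map and the vertices of its image.

∈-allSubsets : ∀ {k n} (J : k ⊑ n) → J ∈ᴸ allSubsets k n
∈-allSubsets done = here ≡.refl
∈-allSubsets (take J) = ∈-++⁺ˡ (∈-map⁺ take (∈-allSubsets J))
∈-allSubsets {zero} (skip J) = ∈-map⁺ skip (∈-allSubsets J)
∈-allSubsets {suc k} {suc n} (skip J) = ∈-++⁺ʳ (map take (allSubsets k n)) (∈-map⁺ skip (∈-allSubsets J))

HasElementOutside : ∀ {k l n} → k ⊑ n → l ⊑ n → Set
HasElementOutside K J = ∃ λ p → ∃ λ q → position J (elem K p) ≡ inj₂ q

-- Serves `equal-or-outside` when J contains the first element and K does not: the remaining parts
-- then differ in size.
larger-outside : ∀ {k l n} (K : k ⊑ n) (J : l ⊑ n) → l ℕ.< k → HasElementOutside K J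
larger-outside (take K) (take J) (s≤s l<k) with p , q , e ← larger-outside K J l<k =
  suc p , q , ≡.cong (⊎.map₁ suc) e
larger-outside (take K) (skip J) _ = zero , zero , ≡.refl
larger-outside (skip K) (take J) l<k with p , q , e ← larger-outside K J (<⇒≤ l<k) =
  p , q , ≡.cong (⊎.map₁ suc) e
larger-outside (skip K) (skip J) l<k with p , q , e ← larger-outside K J l<k =
  p , suc q , ≡.cong (⊎.map₂ suc) e

equal-or-outside : ∀ {k n} (K J : k ⊑ n) → K ≡ J ⊎ HasElementOutside K J
equal-or-outside done     done     = inj₁ ≡.refl
equal-or-outside (take K) (take J) with equal-or-outside K J
... | inj₁ ≡.refl      = inj₁ ≡.refl
... | inj₂ (p , q , e) = inj₂ (suc p , q , ≡.cong (⊎.map₁ suc) e)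
equal-or-outside (take K) (skip J) = inj₂ (zero , zero , ≡.refl)
equal-or-outside {suc k} (skip K) (take J) with p , q , e ← larger-outside K J (n<1+n k) =
  inj₂ (p , q , ≡.cong (⊎.map₁ suc) e)
equal-or-outside (skip K) (skip J) with equal-or-outside K J
... | inj₁ ≡.refl      = inj₁ ≡.refl
... | inj₂ (p , q , e) = inj₂ (p , suc q , ≡.cong (⊎.map₂ suc) e)

module MomentMap (ℝ : CompleteOrderedField) where

  open Grassmannian ℝ hiding (sum-δ; δ; det; Matrix; sum-0)
  open ComplexField ℝ
  open PolynomialExpressions ℝ using (origin)
  open OrbitClosures ℝ
  open Charts ℝ
  open SmoothOrbitClosures ℝ
  private
    module R = CompleteOrderedField ℝ
    module C = CommutativeRing ℂ-commutativeRing
  open LinearAlgebra ℂ-decidableField using (det-zero-row)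
  open SetoidReasoning R.setoid

  private variable
    k n : ℕ

  norm : Gr k n → k ⊑ n → R.Carrier
  norm X K = ∥ Plücker X K ∥²

  norm-nonNegative : ∀ (X : Gr k n) K → NonNegative (norm X K)
  norm-nonNegative X K = ∥∥²-nonNegative (Plücker X K)

  total : Gr k n → R.Carrier
  total X = ∑⊑ (norm X)

  total≉0 : ∀ (X : Gr k n) → ¬ total X R.≈ R.0#
  total≉0 X e = let K , XK≉0 = independent-minor (matrix X) (independent X) in
    XK≉0 (∥∥²-zero (∑-zero (norm-nonNegative X) (∈-allSubsets K) e))

  indicator-elem : ∀ (J : k ⊑ n) p → indicator J (elem J p) R.≈ R.1#
  indicator-elem J p rewrite position-elem J p = R.refl

  indicator-outside : ∀ (J : k ⊑ n) {i q} → position J i ≡ inj₂ q → indicator J i R.≈ R.0#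
  indicator-outside J e rewrite e = R.refl

  -- K has an element outside J, and the row of that element is zero at the origin.
  chart-origin-vanishing : ∀ (J K : k ⊑ n) → K ≢ J → Plücker (chart J origin) K ≈ 0#
  chart-origin-vanishing J K K≢J with equal-or-outside K J
  ... | inj₁ K≡J = contradiction K≡J K≢J
  ... | inj₂ (p , q , e) = C.trans (det≈ (chartMatrix J origin ∘ elem K))
    (det-zero-row (chartMatrix J origin ∘ elem K) p λ j → C.reflexive (row j))
    where
    row : ∀ j → chartMatrix J origin (elem K p) j ≡ 0#
    row j rewrite e = ≡.refl

  -- Only K = J carries weight, so `indicator K` may be replaced by `indicator J` in every term and
  -- taken out of the sum.
  μ-chart-origin : ∀ (J : k ⊑ n) i → indicator J i R.≈ μ (chart J origin) i
  μ-chart-origin {k} {n} J i = R.sym (begin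
    ∑⊑ (λ K → norm E K R.* indicator K i) R.* total E R.⁻¹
      ≈⟨ R.*-congʳ (∑-cong same (allSubsets k n)) ⟩
    ∑⊑ (λ K → norm E K R.* indicator J i) R.* total E R.⁻¹
      ≈⟨ R.*-congʳ (*-distribʳ-∑ (indicator J i) (norm E) (allSubsets k n)) ⟩
    total E R.* indicator J i R.* total E R.⁻¹
      ≈⟨ R.trans (R.*-congʳ (R.*-comm _ _)) (R.*-assoc _ _ _) ⟩
    indicator J i R.* (total E R.* total E R.⁻¹)
      ≈⟨ R.*-congˡ (R.⁻¹-inverseʳ (total E) (total≉0 E)) ⟩
    indicator J i R.* R.1#
      ≈⟨ R.*-identityʳ _ ⟩
    indicator J i ∎)
    where
    E = chart J origin
    same : ∀ K → norm E K R.* indicator K i R.≈ norm E K R.* indicator J i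
    same K with equal-or-outside K J
    ... | inj₁ ≡.refl = R.refl
    ... | inj₂ (p , q , e) = R.trans (R.trans (R.*-congʳ z) (R.zeroˡ _)) (R.sym (R.trans (R.*-congʳ z) (R.zeroˡ _)))
      where
      z : norm E K R.≈ R.0#
      z = zero-∥∥² (chart-origin-vanishing J K λ { ≡.refl → contradiction (≡.trans (≡.sym (position-elem J p)) e) λ () })

  -- If μ(Z) = δ_J, every K with P^K(Z) ≠ 0 contains J, so that K = J.
  μ-vertex : ∀ (Z : Gr k n) J → (∀ i → indicator J i R.≈ μ Z i) → ¬ Plücker Z J ≈ 0#
  μ-vertex {k} {n} Z J e ZJ≈0 = total≉0 Z (∑-0 (allSubsets k n))
    where
    inside outside : Fin n → k ⊑ n → R.Carrier
    inside i K = norm Z K R.* indicator K i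
    outside i K = norm Z K R.* (R.1# R.- indicator K i)

    inside-total : ∀ p → ∑⊑ (inside (elem J p)) R.≈ total Z
    inside-total p = begin
      ∑⊑ (inside (elem J p))
        ≈⟨ R.*-identityʳ _ ⟨
      ∑⊑ (inside (elem J p)) R.* R.1#
        ≈⟨ R.*-congˡ (R.⁻¹-inverseʳ (total Z) (total≉0 Z)) ⟨
      ∑⊑ (inside (elem J p)) R.* (total Z R.* total Z R.⁻¹)
        ≈⟨ R.trans (R.*-congˡ (R.*-comm _ _)) (R.sym (R.*-assoc _ _ _)) ⟩
      μ Z (elem J p) R.* total Z
        ≈⟨ R.*-congʳ (R.trans (R.sym (e (elem J p))) (indicator-elem J p)) ⟩
      R.1# R.* total Z
        ≈⟨ R.*-identityˡ _ ⟩
      total Z ∎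

    -- The two kinds of weight add up to the total, which `inside` already exhausts because μ(Z) has
    -- coordinate 1 at each element of J.
    outside-total : ∀ p → ∑⊑ (outside (elem J p)) R.≈ R.0#
    outside-total p = GroupProperties.identityʳ-unique R.+-group (total Z) _ (begin
      total Z R.+ ∑⊑ (outside (elem J p))
        ≈⟨ R.+-congʳ (inside-total p) ⟨
      ∑⊑ (inside (elem J p)) R.+ ∑⊑ (outside (elem J p))
        ≈⟨ ∑-distrib-+ (inside (elem J p)) (outside (elem J p)) (allSubsets k n) ⟨
      ∑⊑ (λ K → inside (elem J p) K R.+ outside (elem J p) K)
        ≈⟨ ∑-cong (λ K → R.trans (R.sym (R.distribˡ (norm Z K) (indicator K (elem J p)) (R.1# R.- indicator K (elem J p))))
             (R.trans (R.*-congˡ (R.trans (R.+-comm _ _) (R.trans (R.+-assoc _ _ _)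
               (R.trans (R.+-congˡ (R.-‿inverseˡ _)) (R.+-identityʳ _))))) (R.*-identityʳ (norm Z K)))) (allSubsets k n) ⟩
      total Z ∎)

    outside-nonNegative : ∀ i K → NonNegative (outside i K)
    outside-nonNegative i K with position K i
    ... | inj₁ _ = inj₂ (R.trans (R.*-congˡ (R.-‿inverseʳ R.1#)) (R.zeroʳ _))
    ... | inj₂ _ = nonNegative-resp (R.sym (R.trans (R.*-congˡ (R.trans (R.+-congˡ (RingProperties.-0#≈0# R.ring)) (R.+-identityʳ R.1#))) (R.*-identityʳ _)))
                     (norm-nonNegative Z K)
      where
      nonNegative-resp : ∀ {x y} → x R.≈ y → NonNegative x → NonNegative y
      nonNegative-resp x≈y (inj₁ 0<x) = inj₁ (<-respʳ-≈ x≈y 0<x)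
      nonNegative-resp x≈y (inj₂ x≈0) = inj₂ (R.trans (R.sym x≈y) x≈0)

    norm≈0 : ∀ K → norm Z K R.≈ R.0#
    norm≈0 K with equal-or-outside J K
    ... | inj₁ ≡.refl = zero-∥∥² ZJ≈0
    ... | inj₂ (p , q , f) = begin
      norm Z K
        ≈⟨ R.*-identityʳ _ ⟨
      norm Z K R.* R.1#
        ≈⟨ R.*-congˡ (R.trans (R.+-congˡ (R.trans (R.-‿cong (indicator-outside K f)) (RingProperties.-0#≈0# R.ring))) (R.+-identityʳ R.1#)) ⟨
      outside (elem J p) K
        ≈⟨ ∑-zero (outside-nonNegative (elem J p)) (∈-allSubsets K) (outside-total p) ⟩
      R.0# ∎

    ∑-0 : ∀ Ks → ∑ (norm Z) Ks R.≈ R.0#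
    ∑-0 []       = R.refl
    ∑-0 (K ∷ Ks) = R.trans (R.+-cong (norm≈0 K) (∑-0 Ks)) (R.+-identityˡ R.0#)

  vertex∈image : ∀ (X : Gr k n) J → ¬ Plücker X J ≈ 0# → indicator J ∈ μ[ OrbitClosure X ]
  vertex∈image X J XJ≉0 = let a , l , X≈a = chart-of X J XJ≉0 in
    chart J origin , origin∈closure X J XJ≉0 a l X≈a , μ-chart-origin J

  image-vertex : ∀ (Y : Gr k n) J → indicator J ∈ μ[ OrbitClosure Y ] → ¬ Plücker Y J ≈ 0#
  image-vertex Y J (Z , Z∈Y , e) YJ≈0 = μ-vertex Z J e (closure-vanishing {X = Y} {Z} Z∈Y J YJ≈0)

mainTheorem3 : (ℝ : CompleteOrderedField) → let open Grassmannian ℝ in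
    (k n : ℕ) → k ≤ n → 1 ≤ n → (X Y : Gr k n) →
    Smooth (OrbitClosure X) → Smooth (OrbitClosure Y) →
    μ[ OrbitClosure X ] ≐′ μ[ OrbitClosure Y ] →
    OrbitClosure X ≐′ OrbitClosure Y
mainTheorem3 ℝ k n _ _ X Y smoothX smoothY (X⊆Y , Y⊆X) =
    closure-⊆ Y X smoothY Y→X X→Y , closure-⊆ X Y smoothX X→Y Y→X
  where
  open Grassmannian ℝ
  open SmoothOrbitClosures ℝ
  open MomentMap ℝ

  X→Y : ∀ K → ¬ Plücker X K ≈ 0# → ¬ Plücker Y K ≈ 0#
  X→Y K XK≉0 = image-vertex Y K (X⊆Y _ (vertex∈image X K XK≉0))

  Y→X : ∀ K → ¬ Plücker Y K ≈ 0# → ¬ Plücker X K ≈ 0#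
  Y→X K YK≉0 = image-vertex X K (Y⊆X _ (vertex∈image Y K YK≉0))
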